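{- Every FMP instance $\mathscr{F}$ has an equivalent FMP instance $\mathscr{F}'$ ($\mathscr{F}$ has a solution iff $\mathscr{F}'$ has a solution), computable from $\mathscr{F}$ in polynomial time, such that: every tradeoff set of $\mathscr{F}'$ contains at most three tradeoffs; every tradeoff set contains at most one fractional tradeoff; every tradeoff set containing a fractional tradeoff consists of exactly two tradeoffs; every fractional tradeoff has the form $\{p\,b_i,(1-p)\,b_j\}$ with $0<p<1$; and every element $b_j$ occurring in the second fragment of such a fractional tradeoff is free in $\mathscr{F}'$.
   Context: An FMP instance is a triple $(G,B,\{\mathscr{T}_g\}_{g\in G})$ with $G,B$ finite sets and, for each $g\in G$, $\mathscr{T}_g$ a finite set of tradeoffs; a tradeoff is a finite collection $\{p_1b_1,\dots,p_kb_k\}$ of fragments $p_jb_j$ with $b_j\in B$, rational $0\le p_j\le1$, $\sum_jp_j=1$. A solution is a choice of one tradeoff $t_g\in\mathscr{T}_g$ for each $g$ such that for each $b\in B$ the total coefficient of $b$ over all chosen $t_g$ is at most $1$. A tradeoff is integral if it is of the form $\{b\}$ (one element with coefficient 1), and fractional otherwise. Let $F$ be the multiset of all fragments appearing across all tradeoffs of all tradeoff sets; an element $b\in B$ is free if $\sum_{pb\in F}p\le 1$. -}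

module Defs where

open import Data.Bool.Base using (Bool; true; false)
open import Data.Bool.Properties using () renaming (_≟_ to _≟ᵇ_)
open import Data.Fin.Base using (Fin)
open import Data.Integer.Base using (∣_∣)
open import Data.List.Base
  using (List; []; _∷_; map; concat; filter; foldr; tabulate; length; lookup)
open import Data.List.Membership.Propositional using (_∈_)
open import Data.List.Properties using (≡-dec)
open import Data.List.Relation.Unary.All using (All)
open import Data.Nat.Base using (ℕ; suc; _+_; _*_; _^_; _≤_)
open import Data.Nat.Binary.Base using (ℕᵇ; zero; 2[1+_]; 1+[2_]; fromℕ)
open import Data.Product.Base using (Σ-syntax; ∃-syntax; _×_; _,_; proj₁; proj₂)
open import Data.Rational.Base as ℚ using (ℚ; 0ℚ; 1ℚ; ↥_; ↧ₙ_)
open import Function.Bundles using (_⇔_)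
open import Relation.Binary.Definitions using (DecidableEquality)
open import Relation.Binary.PropositionalEquality.Core using (_≡_)
open import Relation.Nullary.Negation.Core using (¬_)

------------------------------------------------------------------------
-- FMP instances

-- Finite sets that are part of the input are given by lists.  Members of
-- B are named by bit strings, members of G by positions.

Element : Set
Element = List Bool

_≟ᴱ_ : DecidableEquality Element
_≟ᴱ_ = ≡-dec _≟ᵇ_

-- (p , b) is the fragment pb.
Fragment : Set
Fragment = ℚ × Element

Tradeoff : Set
Tradeoff = List Fragment

sumℚ : List ℚ → ℚ
sumℚ = foldr ℚ._+_ 0ℚ

record IsTradeoff (B : List Element) (t : Tradeoff) : Set where
  field
    elements : All (λ (p , b) → b ∈ B) t
    bounds   : All (λ (p , b) → 0ℚ ℚ.≤ p × p ℚ.≤ 1ℚ) t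
    total    : sumℚ (map proj₁ t) ≡ 1ℚ

record FMP : Set where
  field
    ∣G∣        : ℕ
    B          : List Element
    T          : Fin ∣G∣ → List Tradeoff
    isTradeoff : ∀ g → All (IsTradeoff B) (T g)

-- The total coefficient of b in a multiset of fragments.
load : Element → List Fragment → ℚ
load b fs = sumℚ (map proj₁ (filter (λ f → proj₂ f ≟ᴱ b) fs))

module _ (ℱ : FMP) where
  open FMP ℱ

  record Solution : Set where
    field
      choice   : Fin ∣G∣ → Tradeoff
      choice∈T : ∀ g → choice g ∈ T g
      capacity : All (λ b → load b (concat (tabulate choice)) ℚ.≤ 1ℚ) B

  allFragments : List Fragment
  allFragments = concat (concat (tabulate T))

  Free : Element → Set
  Free b = load b allFragments ℚ.≤ 1ℚ

Equivalent : FMP → FMP → Set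
Equivalent ℱ ℱ′ = Solution ℱ ⇔ Solution ℱ′

Integral : Tradeoff → Set
Integral t = ∃[ b ] t ≡ (1ℚ , b) ∷ []

Fractional : Tradeoff → Set
Fractional t = ¬ Integral t

-- Counted with multiplicity in the list.
AtMostOneFractional : List Tradeoff → Set
AtMostOneFractional ts =
  ∀ (i j : Fin (length ts)) →
  Fractional (lookup ts i) → Fractional (lookup ts j) → i ≡ j

------------------------------------------------------------------------
-- Polynomial time

-- The machine model is the WHILE language over binary trees with the
-- single atom nil (N. D. Jones, "Computability and Complexity"), in
-- variable-free form: a program maps a tree to a tree.  It is
-- Turing-complete, and its polynomial time is that of Turing machines.

infixr 5 _∙_

data Data : Set where
  nil : Data
  _∙_ : Data → Data → Data

size : Data → ℕ
size nil     = 1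
size (x ∙ y) = suc (size x + size y)

hd tl : Data → Data
hd nil     = nil
hd (x ∙ y) = x
tl nil     = nil
tl (x ∙ y) = y

infixr 4 _⨾_

data Prog : Set where
  idᵖ nilᵖ hdᵖ tlᵖ : Prog
  ⟨_,_⟩            : Prog → Prog → Prog
  _⨾_              : Prog → Prog → Prog
  if_then_else_    : Prog → Prog → Prog → Prog
  while_loop_      : Prog → Prog → Prog

infix 2 _⊢_⇓_[_]

-- p ⊢ x ⇓ y [ t ]: on input x, p halts with output y in time t.
-- A test succeeds when its value is not nil.  Every step is charged the
-- size of the tree it acts on, not one unit: otherwise repeated ⟨ idᵖ , idᵖ ⟩
-- would build a tree of exponential size in linear time.  With this
-- charge, size y ≤ t.
data _⊢_⇓_[_] : Prog → Data → Data → ℕ → Set where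
  id⇓   : ∀ {x} → idᵖ  ⊢ x ⇓ x    [ size x ]
  nil⇓  : ∀ {x} → nilᵖ ⊢ x ⇓ nil  [ size x ]
  hd⇓   : ∀ {x} → hdᵖ  ⊢ x ⇓ hd x [ size x ]
  tl⇓   : ∀ {x} → tlᵖ  ⊢ x ⇓ tl x [ size x ]
  pair⇓ : ∀ {p q x y z t u} →
          p ⊢ x ⇓ y [ t ] → q ⊢ x ⇓ z [ u ] →
          ⟨ p , q ⟩ ⊢ x ⇓ y ∙ z [ size x + (t + u) ]
  seq⇓  : ∀ {p q x y z t u} →
          p ⊢ x ⇓ y [ t ] → q ⊢ y ⇓ z [ u ] →
          (p ⨾ q) ⊢ x ⇓ z [ size x + (t + u) ]
  then⇓ : ∀ {b p q x v w y t u} →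
          b ⊢ x ⇓ v ∙ w [ t ] → p ⊢ x ⇓ y [ u ] →
          (if b then p else q) ⊢ x ⇓ y [ size x + (t + u) ]
  else⇓ : ∀ {b p q x y t u} →
          b ⊢ x ⇓ nil [ t ] → q ⊢ x ⇓ y [ u ] →
          (if b then p else q) ⊢ x ⇓ y [ size x + (t + u) ]
  stop⇓ : ∀ {b p x t} →
          b ⊢ x ⇓ nil [ t ] →
          (while b loop p) ⊢ x ⇓ x [ size x + t ]
  step⇓ : ∀ {b p x v w y z t u s} →
          b ⊢ x ⇓ v ∙ w [ t ] → p ⊢ x ⇓ y [ u ] →
          (while b loop p) ⊢ y ⇓ z [ s ] →
          (while b loop p) ⊢ x ⇓ z [ size x + (t + (u + s)) ]

PolyTime : {X Y : Set} → (X → Data) → (Y → Data) → (X → Y) → Set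
PolyTime encX encY f =
  Σ[ p ∈ Prog ] ∃[ c ] ∃[ k ] (∀ x →
    ∃[ t ] (p ⊢ encX x ⇓ encY (f x) [ t ]) × t ≤ c * size (encX x) ^ k)

------------------------------------------------------------------------
-- Encoding of instances

encList : {X : Set} → (X → Data) → List X → Data
encList enc []       = nil
encList enc (x ∷ xs) = enc x ∙ encList enc xs

encBool : Bool → Data
encBool false = nil
encBool true  = nil ∙ nil

encℕᵇ : ℕᵇ → Data
encℕᵇ zero     = nil
encℕᵇ 2[1+ n ] = encBool false ∙ encℕᵇ n
encℕᵇ 1+[2 n ] = encBool true ∙ encℕᵇ n

-- Numerator and denominator in lowest terms, both in binary.  There is no
-- sign because coefficients are nonnegative.
encCoefficient : ℚ → Data
encCoefficient p = encℕᵇ (fromℕ ∣ ↥ p ∣) ∙ encℕᵇ (fromℕ (↧ₙ p))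

encElement : Element → Data
encElement = encList encBool

encFragment : Fragment → Data
encFragment (p , b) = encCoefficient p ∙ encElement b

encTradeoff : Tradeoff → Data
encTradeoff = encList encFragment

encFMP : FMP → Data
encFMP ℱ = encList encElement B ∙ encList (encList encTradeoff) (tabulate T)
  where open FMP ℱ

{-# OPTIONS --safe #-}

-- A fractional tradeoff can hold p of an element bᵢ only together with a
-- free, hence irrelevant, sink.  For a fragment pb of a tradeoff t take the
-- sets {{p x , (1-p) sink}, {s}} and {{s}, {p b , (1-p) sink′}}, where the
-- slot s belongs to this fragment and the selector x is shared by the
-- fragments of t.  If x is full, then s is taken by the first set and b gets
-- its p from the second one; otherwise all the fragments of t fit on x
-- together, because their coefficients have sum 1, and every s stays
-- available.  So filling x selects t.  Links c₀ , … , cₘ make a group with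
-- tradeoffs 1 , … , m fill a selector: c₀ and cₘ are filled by sets {c₀} and
-- {cₘ}, and tradeoff i contributes the set {cᵢ , xᵢ , cᵢ₋₁}; these m + 2
-- sets cannot share the m + 1 links.  The only arithmetic that the reduction
-- performs is 1 - p, a subtraction of binary numerals.
module Submission where

open import Defs
open import Data.Bool.Base using (Bool; true; false) renaming (if_then_else_ to ifᵇ_then_else_)
open import Data.Empty using (⊥-elim)
open import Data.List.Base using (List; []; _∷_; _++_; length; map; concat; tabulate; lookup)
open import Data.List.Membership.Propositional using (_∈_)
open import Data.List.Relation.Unary.All as All using (All; []; _∷_)
open import Data.Nat.Base using (ℕ; zero; suc)
open import Data.Product.Base using (Σ; Σ-syntax; ∃-syntax; _×_; _,_; proj₁; proj₂)
open import Data.Rational.Base as ℚ using (ℚ; 0ℚ; 1ℚ)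
import Data.Rational.Properties as ℚ
open import Data.Unit.Base using (tt)
open import Function.Base using (_∘_)
open import Relation.Binary.PropositionalEquality
open import Relation.Nullary using (¬_; yes; no; does)

-- The reduced instance

-- Going back from the reduced instance needs only inequalities: in each group some tradeoff has a
-- full selector, and the load that it puts on `b` is at most the load of `original b`. Hence
-- several full selectors in one group, or capacity wasted elsewhere, do no harm. The extreme
-- coefficients have to be kept out of the fractional tradeoffs. A fragment with p = 0 demands
-- nothing and gets no sets; for p = 1 the fragment on the sink has coefficient 0 and is left out,
-- which makes `spread` integral. What remains has 0 < p < 1. A group without tradeoffs has c₀ = cₘ,
-- so its two end sets collide and the reduced instance is unsolvable too, as it must be. Numbering
-- by suffix length separates equal tradeoffs and equal fragments at different positions. It also
-- suits the machine: a program that holds a suffix can print its length in unary without a counter,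
-- and the names stay linear in the size of the input.

concatSuffixes : {A B : Set} → (A → List A → List B) → List A → List B
concatSuffixes f []       = []
concatSuffixes f (x ∷ xs) = f x xs ++ concatSuffixes f xs

-- Self-delimiting, so that four numerals in a row can be told apart again. The leading bit of a
-- name separates `original` from `fresh`.
unary : ℕ → Element → Element
unary zero    e = false ∷ e
unary (suc n) e = true ∷ unary n e

original : Element → Element
original b = false ∷ b

-- Opaque, so that the indices can be inferred by unification.
opaque
  fresh : ℕ → ℕ → ℕ → ℕ → Element
  fresh g i j k = true ∷ unary g (unary i (unary j (unary k [])))

-- Groups, tradeoffs and fragments are indexed by the length of the
-- suffix that they start.
link selector : ℕ → ℕ → Element
link     g i = fresh g i 0 0
selector g i = fresh g i 0 1

-- Third index 0 is taken by links and selectors, and fourth index 0 by the slot, whence the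
-- successors here and in `sink`.
slot : ℕ → ℕ → ℕ → Element
slot g i j = fresh g i (suc j) 0

sink : ℕ → ℕ → ℕ → ℕ → Element
sink g i j k = fresh g i (suc j) (suc k)

single : Element → Tradeoff
single e = (1ℚ , e) ∷ []

spread : ℚ → Element → Element → Tradeoff
spread p y z = (p , y) ∷ (ifᵇ does (1ℚ ℚ.- p ℚ.≟ 0ℚ) then [] else (1ℚ ℚ.- p , z) ∷ [])

fragmentSets : ℕ → ℕ → Fragment → List Fragment → List (List Tradeoff)
fragmentSets g i (p , b) fs = ifᵇ does (p ℚ.≟ 0ℚ) then [] else
  (spread p (selector g i) (sink g i j 0) ∷ single (slot g i j) ∷ []) ∷
  (single (slot g i j) ∷ spread p (original b) (sink g i j 1) ∷ []) ∷ []
  where j = length fs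

tradeoffSets : ℕ → Tradeoff → List Tradeoff → List (List Tradeoff)
tradeoffSets g t ts =
  (single (link g (suc i)) ∷ single (selector g (suc i)) ∷ single (link g i) ∷ []) ∷
  concatSuffixes (fragmentSets g (suc i)) t
  where i = length ts

groupSets : List Tradeoff → List (List Tradeoff) → List (List Tradeoff)
groupSets ts tss =
  (single (link g 0) ∷ []) ∷ (single (link g (length ts)) ∷ []) ∷
  concatSuffixes (tradeoffSets g) ts
  where g = suc (length tss)

reducedSets : List (List Tradeoff) → List (List Tradeoff)
reducedSets = concatSuffixes groupSets

-- The new `B` consists of the occurring elements, with repetitions. An element that occurs in no
-- tradeoff has load 0, so its capacity constraint is void.
elementsOf : List (List Tradeoff) → List Element
elementsOf =
  concatSuffixes λ ts _ → concatSuffixes (λ t _ → concatSuffixes (λ f _ → proj₂ f ∷ []) t) ts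

Bounded : Fragment → Set
Bounded (p , b) = 0ℚ ℚ.≤ p × p ℚ.≤ 1ℚ

-- Programs that run in polynomial time

module PolynomialTime where

  open import Data.Nat.Base using (_+_; _*_; _^_; _≤_; z≤n; s≤s)
  open import Data.Nat.Properties
  open import Data.Nat.Tactic.RingSolver using (solve-∀)

  -- Polynomial bounds

  infixl 6 _⊕_
  infixl 7 _⊗_
  infixr 8 _⊚_

  -- Syntax instead of functions on ℕ, so that monotonicity and a bound by a single monomial follow
  -- by recursion. `_⊚_` is the cost of running one program on the output of another.
  data Poly : Set where
    var         : Poly
    con         : ℕ → Poly
    _⊕_ _⊗_ _⊚_ : Poly → Poly → Poly

  ⟦_⟧ : Poly → ℕ → ℕ
  ⟦ var ⟧   n = n
  ⟦ con c ⟧ n = c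
  ⟦ P ⊕ Q ⟧ n = ⟦ P ⟧ n + ⟦ Q ⟧ n
  ⟦ P ⊗ Q ⟧ n = ⟦ P ⟧ n * ⟦ Q ⟧ n
  ⟦ P ⊚ Q ⟧ n = ⟦ P ⟧ (⟦ Q ⟧ n)

  ⟦⟧-mono : ∀ P {m n} → m ≤ n → ⟦ P ⟧ m ≤ ⟦ P ⟧ n
  ⟦⟧-mono var     m≤n = m≤n
  ⟦⟧-mono (con c) m≤n = ≤-refl
  ⟦⟧-mono (P ⊕ Q) m≤n = +-mono-≤ (⟦⟧-mono P m≤n) (⟦⟧-mono Q m≤n)
  ⟦⟧-mono (P ⊗ Q) m≤n = *-mono-≤ (⟦⟧-mono P m≤n) (⟦⟧-mono Q m≤n)
  ⟦⟧-mono (P ⊚ Q) m≤n = ⟦⟧-mono P (⟦⟧-mono Q m≤n)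

  -- Deliberately crude. Degrees add even under `_⊕_`: for n ≥ 1 both summands can be raised to the
  -- common power. A constant `c` counts as `suc c` to keep all coefficients positive; the case of
  -- `_⊚_` needs an inner monomial that is at least 1.
  coefficient degree : Poly → ℕ
  coefficient var     = 1
  coefficient (con c) = suc c
  coefficient (P ⊕ Q) = coefficient P + coefficient Q
  coefficient (P ⊗ Q) = coefficient P * coefficient Q
  coefficient (P ⊚ Q) = coefficient P * coefficient Q ^ degree P
  degree var     = 1
  degree (con c) = 0
  degree (P ⊕ Q) = degree P + degree Q
  degree (P ⊗ Q) = degree P + degree Q
  degree (P ⊚ Q) = degree Q * degree P

  coefficient>0 : ∀ P → 1 ≤ coefficient P
  coefficient>0 var     = ≤-refl
  coefficient>0 (con c) = s≤s z≤n
  coefficient>0 (P ⊕ Q) = ≤-trans (coefficient>0 P) (m≤m+n _ _)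
  coefficient>0 (P ⊗ Q) = *-mono-≤ (coefficient>0 P) (coefficient>0 Q)
  coefficient>0 (P ⊚ Q) =
    *-mono-≤ (coefficient>0 P)
      (subst (_≤ coefficient Q ^ degree P) (^-zeroˡ (degree P))
        (^-monoˡ-≤ (degree P) (coefficient>0 Q)))

  1≤^ : ∀ {n} k → 1 ≤ n → 1 ≤ n ^ k
  1≤^ {n} k 1≤n = subst (_≤ n ^ k) (^-zeroˡ k) (^-monoˡ-≤ k 1≤n)

  ^-distribʳ-* : ∀ k m n → (m * n) ^ k ≡ m ^ k * n ^ k
  ^-distribʳ-* zero    m n = refl
  ^-distribʳ-* (suc k) m n =
    trans (cong (m * n *_) (^-distribʳ-* k m n)) ([m*n]*[o*p]≡[m*o]*[n*p] m n (m ^ k) (n ^ k))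

  ⟦⟧≤monomial : ∀ P {n} → 1 ≤ n → ⟦ P ⟧ n ≤ coefficient P * n ^ degree P
  ⟦⟧≤monomial var {n} 1≤n = ≤-reflexive (sym (trans (*-identityˡ (n * 1)) (*-identityʳ n)))
  ⟦⟧≤monomial (con c) 1≤n = ≤-trans (n≤1+n c) (≤-reflexive (sym (*-identityʳ (suc c))))
  ⟦⟧≤monomial (P ⊕ Q) {n} 1≤n = begin
    ⟦ P ⟧ n + ⟦ Q ⟧ n                        ≤⟨ +-mono-≤ (⟦⟧≤monomial P 1≤n) (⟦⟧≤monomial Q 1≤n) ⟩
    a * n ^ k + b * n ^ l
      ≡⟨ cong₂ (λ x y → a * x + b * y) (sym (*-identityʳ _)) (sym (*-identityˡ _)) ⟩
    a * (n ^ k * 1) + b * (1 * n ^ l)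
      ≤⟨ +-mono-≤ (*-monoʳ-≤ a (*-monoʳ-≤ (n ^ k) (1≤^ l 1≤n)))
                                                  (*-monoʳ-≤ b (*-monoˡ-≤ (n ^ l) (1≤^ k 1≤n))) ⟩
    a * (n ^ k * n ^ l) + b * (n ^ k * n ^ l) ≡⟨ sym (*-distribʳ-+ _ a b) ⟩
    (a + b) * (n ^ k * n ^ l)                ≡⟨ cong ((a + b) *_) (sym (^-distribˡ-+-* n k l)) ⟩
    (a + b) * n ^ (k + l)                    ∎
    where
    open ≤-Reasoning
    a = coefficient P
    b = coefficient Q
    k = degree P
    l = degree Q
  ⟦⟧≤monomial (P ⊗ Q) {n} 1≤n = begin
    ⟦ P ⟧ n * ⟦ Q ⟧ n           ≤⟨ *-mono-≤ (⟦⟧≤monomial P 1≤n) (⟦⟧≤monomial Q 1≤n) ⟩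
    (a * n ^ k) * (b * n ^ l)   ≡⟨ [m*n]*[o*p]≡[m*o]*[n*p] a (n ^ k) b (n ^ l) ⟩
    (a * b) * (n ^ k * n ^ l)   ≡⟨ cong ((a * b) *_) (sym (^-distribˡ-+-* n k l)) ⟩
    (a * b) * n ^ (k + l)       ∎
    where
    open ≤-Reasoning
    a = coefficient P
    b = coefficient Q
    k = degree P
    l = degree Q
  ⟦⟧≤monomial (P ⊚ Q) {n} 1≤n = begin
    ⟦ P ⟧ (⟦ Q ⟧ n)              ≤⟨ ⟦⟧-mono P (⟦⟧≤monomial Q 1≤n) ⟩
    ⟦ P ⟧ (b * n ^ l)            ≤⟨ ⟦⟧≤monomial P (*-mono-≤ (coefficient>0 Q) (1≤^ l 1≤n)) ⟩
    a * (b * n ^ l) ^ k          ≡⟨ cong (a *_) (^-distribʳ-* k b (n ^ l)) ⟩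
    a * (b ^ k * (n ^ l) ^ k)    ≡⟨ cong (λ x → a * (b ^ k * x)) (^-*-assoc n l k) ⟩
    a * (b ^ k * n ^ (l * k))    ≡⟨ sym (*-assoc a (b ^ k) _) ⟩
    a * b ^ k * n ^ (l * k)      ∎
    where
    open ≤-Reasoning
    a = coefficient P
    b = coefficient Q
    k = degree P
    l = degree Q

  -- Polynomial-time functions on trees and their closure properties

  size>0 : ∀ x → 1 ≤ size x
  size>0 nil     = ≤-refl
  size>0 (x ∙ y) = s≤s z≤n

  size-hd : ∀ x → size (hd x) ≤ size x
  size-hd nil     = ≤-refl
  size-hd (x ∙ y) = m≤n⇒m≤1+n (m≤m+n _ _)

  size-tl : ∀ x → size (tl x) ≤ size x
  size-tl nil     = ≤-refl
  size-tl (x ∙ y) = m≤n⇒m≤1+n (m≤n+m _ _)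

  -- Holds because every step is charged the size of its tree. A time bound thus also bounds the
  -- intermediate result that is fed to the next program.
  output≤time : ∀ {p x y t} → p ⊢ x ⇓ y [ t ] → size y ≤ t
  output≤time id⇓               = ≤-refl
  output≤time (nil⇓ {x})        = size>0 x
  output≤time (hd⇓ {x})         = size-hd x
  output≤time (tl⇓ {x})         = size-tl x
  output≤time (pair⇓ {x = x} d e) =
    +-mono-≤ (size>0 x) (+-mono-≤ (output≤time d) (output≤time e))
  output≤time (seq⇓ {x = x} d e)  = ≤-trans (output≤time e) (≤-trans (m≤n+m _ _) (m≤n+m _ (size x)))
  output≤time (then⇓ {x = x} d e) = ≤-trans (output≤time e) (≤-trans (m≤n+m _ _) (m≤n+m _ (size x)))
  output≤time (else⇓ {x = x} d e) = ≤-trans (output≤time e) (≤-trans (m≤n+m _ _) (m≤n+m _ (size x)))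
  output≤time (stop⇓ d)         = m≤m+n _ _
  output≤time (step⇓ {x = x} {t = t} {u = u} d e f) =
    ≤-trans (output≤time f) (≤-trans (m≤n+m _ u) (≤-trans (m≤n+m _ t) (m≤n+m _ (size x))))

  record PT (f : Data → Data) : Set where
    field
      prog  : Prog
      bound : Poly
      runs  : ∀ x → ∃[ t ] (prog ⊢ x ⇓ f x [ t ]) × t ≤ ⟦ bound ⟧ (size x)

    output≤ : ∀ x → size (f x) ≤ ⟦ bound ⟧ (size x)
    output≤ x with t , d , t≤ ← runs x = ≤-trans (output≤time d) t≤

  PT-cong : ∀ {f g} → (∀ x → f x ≡ g x) → PT f → PT g
  PT-cong f≗g F = record
    { prog = prog ; bound = bound
    ; runs = λ x → subst (λ y → ∃[ t ] (prog ⊢ x ⇓ y [ t ]) × t ≤ ⟦ bound ⟧ (size x)) (f≗g x)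
      (runs x) }
    where open PT F

  idᴾ : PT (λ x → x)
  idᴾ = record { prog = idᵖ ; bound = var ; runs = λ x → size x , id⇓ , ≤-refl }

  nilᴾ : PT (λ _ → nil)
  nilᴾ = record { prog = nilᵖ ; bound = var ; runs = λ x → size x , nil⇓ , ≤-refl }

  _∙ᴾ_ : ∀ {f g} → PT f → PT g → PT (λ x → f x ∙ g x)
  F ∙ᴾ G = record
    { prog  = ⟨ F.prog , G.prog ⟩
    ; bound = var ⊕ (F.bound ⊕ G.bound)
    ; runs  = λ x → let t , d , t≤ = F.runs x ; u , e , u≤ = G.runs x in
        size x + (t + u) , pair⇓ d e , +-monoʳ-≤ (size x) (+-mono-≤ t≤ u≤) }
    where
    module F = PT F
    module G = PT G

  _∘ᴾ_ : ∀ {g f} → PT g → PT f → PT (λ x → g (f x))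
  G ∘ᴾ F = record
    { prog  = F.prog ⨾ G.prog
    ; bound = var ⊕ (F.bound ⊕ G.bound ⊚ F.bound)
    ; runs  = λ x → let t , d , t≤ = F.runs x ; u , e , u≤ = G.runs _ in
        size x + (t + u) , seq⇓ d e ,
        +-monoʳ-≤ (size x) (+-mono-≤ t≤ (≤-trans u≤ (⟦⟧-mono G.bound (F.output≤ x)))) }
    where
    module F = PT F
    module G = PT G

  hdᴾ : ∀ {f} → PT f → PT (λ x → hd (f x))
  hdᴾ F = record { prog = hdᵖ ; bound = var ; runs = λ x → size x , hd⇓ , ≤-refl } ∘ᴾ F

  tlᴾ : ∀ {f} → PT f → PT (λ x → tl (f x))
  tlᴾ F = record { prog = tlᵖ ; bound = var ; runs = λ x → size x , tl⇓ , ≤-refl } ∘ᴾ F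

  ifᴰ : Data → Data → Data → Data
  ifᴰ nil     y z = z
  ifᴰ (_ ∙ _) y z = y

  ifᴾ : ∀ {b f g} → PT b → PT f → PT g → PT (λ x → ifᴰ (b x) (f x) (g x))
  ifᴾ {b} {f} {g} B F G = record
    { prog  = if B.prog then F.prog else G.prog
    ; bound = var ⊕ (B.bound ⊕ (F.bound ⊕ G.bound))
    ; runs  = λ x → run x (b x) refl }
    where
    module B = PT B
    module F = PT F
    module G = PT G
    run : ∀ x v → b x ≡ v →
      ∃[ t ] (if B.prog then F.prog else G.prog ⊢ x ⇓ ifᴰ v (f x) (g x) [ t ]) ×
        t ≤ size x + (⟦ B.bound ⟧ (size x) + (⟦ F.bound ⟧ (size x) + ⟦ G.bound ⟧ (size x)))
    run x nil eq with t , d , t≤ ← B.runs x | u , e , u≤ ← G.runs x rewrite eq =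
      size x + (t + u) , else⇓ d e , +-monoʳ-≤ (size x) (+-mono-≤ t≤ (≤-trans u≤ (m≤n+m _ _)))
    run x (v ∙ w) eq with t , d , t≤ ← B.runs x | u , e , u≤ ← F.runs x rewrite eq =
      size x + (t + u) , then⇓ d e , +-monoʳ-≤ (size x) (+-mono-≤ t≤ (≤-trans u≤ (m≤m+n _ _)))

  -- Lists are traversed by suffixes, so that the length of the current
  -- suffix can serve as the index of its first entry.
  foldlᴰ : (Data → Data) → Data → Data → Data → Data
  foldlᴰ f env nil     acc = acc
  foldlᴰ f env (x ∙ l) acc = foldlᴰ f env l (f (env ∙ ((x ∙ l) ∙ acc)))

  -- The accumulator enters with factor one and only a summand independent of it is added. A
  -- polynomial bound in `acc` would not do: a step that pairs `acc` with itself yields exponential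
  -- size after linearly many rounds.
  Growth : (Data → Data) → Set
  Growth f = Σ[ G ∈ Poly ] (∀ env l acc → size (f (env ∙ (l ∙ acc))) ≤
    size acc + ⟦ G ⟧ (size (env ∙ l)))

  module _ {f : Data → Data} (F : PT f) (bounded : Growth f) where

    private
      open Σ bounded renaming (proj₁ to G; proj₂ to growth)

      -- Moves the list to the front of the state, where the loop test `hdᵖ` sees it.
      start : PT (λ x → hd (tl x) ∙ (hd x ∙ tl (tl x)))
      start = hdᴾ (tlᴾ idᴾ) ∙ᴾ (hdᴾ idᴾ ∙ᴾ tlᴾ (tlᴾ idᴾ))

      body : PT (λ s → tl (hd s) ∙ (hd (tl s) ∙ f (hd (tl s) ∙ (hd s ∙ tl (tl s)))))
      body = tlᴾ (hdᴾ idᴾ) ∙ᴾ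
        (hdᴾ (tlᴾ idᴾ) ∙ᴾ (F ∘ᴾ (hdᴾ (tlᴾ idᴾ) ∙ᴾ (hdᴾ idᴾ ∙ᴾ tlᴾ (tlᴾ idᴾ)))))

      module body = PT body

      loop : Prog
      loop = while hdᵖ loop body.prog

      cost : ℕ → ℕ
      cost M = M + (M + ⟦ body.bound ⟧ M)

      regroup : ∀ l e a x g → (suc (l + suc (e + (a + g))) + l * g) + suc x + x * g ≡
                              suc (suc (x + l) + suc (e + a)) + suc (x + l) * g
      regroup = solve-∀

      -- A potential argument. The size of the state plus `size l * ⟦ G ⟧ N` never increases: a
      -- round adds at most `⟦ G ⟧ N` to the accumulator and shortens the list. So `M` bounds every
      -- state, a round costs at most `cost M`, and `size l` bounds the number of rounds, the final
      -- test included.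
      loop-runs : ∀ N M env l acc → size (env ∙ l) ≤ N →
        size (l ∙ (env ∙ acc)) + size l * ⟦ G ⟧ N ≤ M →
        ∃[ t ] (loop ⊢ l ∙ (env ∙ acc) ⇓ nil ∙ (env ∙ foldlᴰ f env l acc) [ t ]) ×
          t ≤ size l * cost M
      loop-runs N M env nil acc _ s≤M =
        _ , stop⇓ hd⇓ ,
        ≤-trans (+-mono-≤ s≤M′ (≤-trans s≤M′ (m≤m+n M _)))
          (≤-reflexive (sym (+-identityʳ (cost M))))
        where
        s≤M′ : size (nil ∙ (env ∙ acc)) ≤ M
        s≤M′ = m+n≤o⇒m≤o _ s≤M
      loop-runs N M env (x ∙ l) acc e≤N s≤M =
        let u , d , u≤ = body.runs ((x ∙ l) ∙ (env ∙ acc))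
            t , e , t≤ = loop-runs N M env l acc′ e≤N′ s′≤M
        in _ , step⇓ hd⇓ d e , (begin
          s + (s + (u + t))
            ≤⟨ +-mono-≤ s≤M′ (+-mono-≤ s≤M′ (+-mono-≤ (≤-trans u≤ (⟦⟧-mono body.bound s≤M′)) t≤)) ⟩
          M + (M + (⟦ body.bound ⟧ M + size l * cost M)) ≡⟨ cong (M +_) (sym (+-assoc M _ _)) ⟩
          M + (M + ⟦ body.bound ⟧ M + size l * cost M) ≡⟨ sym (+-assoc M _ _) ⟩
          suc (size l) * cost M
            ≤⟨ *-monoˡ-≤ (cost M) (s≤s (m≤n+m (size l) (size x))) ⟩
          size (x ∙ l) * cost M                        ∎)
        where
        open ≤-Reasoning
        s = size ((x ∙ l) ∙ (env ∙ acc))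
        acc′ = f (env ∙ ((x ∙ l) ∙ acc))
        s≤M′ : s ≤ M
        s≤M′ = m+n≤o⇒m≤o _ s≤M
        e≤N′ : size (env ∙ l) ≤ N
        e≤N′ = ≤-trans (s≤s (+-monoʳ-≤ (size env) (size-tl (x ∙ l)))) e≤N
        acc′≤ : size acc′ ≤ size acc + ⟦ G ⟧ N
        acc′≤ = ≤-trans (growth env (x ∙ l) acc) (+-monoʳ-≤ (size acc) (⟦⟧-mono G e≤N))
        s′≤M : size (l ∙ (env ∙ acc′)) + size l * ⟦ G ⟧ N ≤ M
        s′≤M = begin
          size (l ∙ (env ∙ acc′)) + size l * ⟦ G ⟧ N
            ≤⟨ +-monoˡ-≤ _ (s≤s (+-monoʳ-≤ (size l) (s≤s (+-monoʳ-≤ (size env) acc′≤)))) ⟩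
          suc (size l + suc (size env + (size acc + ⟦ G ⟧ N))) + size l * ⟦ G ⟧ N
            ≤⟨ ≤-trans (m≤m+n _ (suc (size x))) (m≤m+n _ (size x * ⟦ G ⟧ N)) ⟩
          suc (size l + suc (size env + (size acc + ⟦ G ⟧ N))) + size l * ⟦ G ⟧ N + suc (size x) +
            size x * ⟦ G ⟧ N
            ≡⟨ regroup (size l) (size env) (size acc) (size x) (⟦ G ⟧ N) ⟩
          s + size (x ∙ l) * ⟦ G ⟧ N
            ≤⟨ s≤M ⟩
          M ∎

      loopᴾ : ∃[ P ] ∀ x → ∃[ t ]
        (loop ⊢ hd (tl x) ∙ (hd x ∙ tl (tl x)) ⇓ nil ∙
          (hd x ∙ foldlᴰ f (hd x) (hd (tl x)) (tl (tl x))) [ t ]) ×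
        t ≤ ⟦ P ⟧ (size x)
      loopᴾ = var ⊗ (Mᴾ ⊕ (Mᴾ ⊕ body.bound ⊚ Mᴾ)) , λ x →
        let env≤ = size-hd x
            l≤   = ≤-trans (size-hd (tl x)) (size-tl x)
            acc≤ = ≤-trans (size-tl (tl x)) (size-tl x)
            t , d , t≤ = loop-runs (⟦ Nᴾ ⟧ (size x)) (⟦ Mᴾ ⟧ (size x)) (hd x) (hd (tl x))
              (tl (tl x))
              (s≤s (+-mono-≤ env≤ l≤))
              (+-mono-≤ (s≤s (+-mono-≤ l≤ (s≤s (+-mono-≤ env≤ acc≤)))) (*-monoˡ-≤ _ l≤))
        in t , d , ≤-trans t≤ (*-monoˡ-≤ _ l≤)
        where
        -- The environment, the list and the accumulator are parts of the input, so `var` stands for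
        -- the size of each; `Mᴾ` is the initial potential.
        Nᴾ = con 1 ⊕ (var ⊕ var)
        Mᴾ = con 1 ⊕ (var ⊕ (con 1 ⊕ (var ⊕ var))) ⊕ var ⊗ G ⊚ Nᴾ

    foldlᴾ′ : PT (λ x → foldlᴰ f (hd x) (hd (tl x)) (tl (tl x)))
    foldlᴾ′ = tlᴾ (tlᴾ looped)
      where
      module start = PT start
      looped : PT (λ x → nil ∙ (hd x ∙ foldlᴰ f (hd x) (hd (tl x)) (tl (tl x))))
      looped = record
        { prog  = start.prog ⨾ loop
        ; bound = var ⊕ (start.bound ⊕ proj₁ loopᴾ)
        ; runs  = λ x → let t , d , t≤ = start.runs x ; u , e , u≤ = proj₂ loopᴾ x in
            size x + (t + u) , seq⇓ d e , +-monoʳ-≤ (size x) (+-mono-≤ t≤ u≤) }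

    foldlᴾ : ∀ {e l a} → PT e → PT l → PT a → PT (λ x → foldlᴰ f (e x) (l x) (a x))
    foldlᴾ E L A = foldlᴾ′ ∘ᴾ (E ∙ᴾ (L ∙ᴾ A))

  foldrᴰ : (Data → Data) → Data → Data → Data → Data
  foldrᴰ f env nil     z = z
  foldrᴰ f env (x ∙ l) z = f (env ∙ ((x ∙ l) ∙ foldrᴰ f env l z))

  private
    push : Data → Data
    push s = hd (tl s) ∙ tl (tl s)

    pushᴾ : PT push
    pushᴾ = hdᴾ (tlᴾ idᴾ) ∙ᴾ tlᴾ (tlᴾ idᴾ)

    push-growth : Growth push
    push-growth = var , λ env l acc → ≤-trans
      (s≤s (≤-trans (m≤n+m _ (size env)) (≤-reflexive (sym (+-assoc (size env) _ _)))))
      (≤-reflexive (+-comm (size (env ∙ l)) (size acc)))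

  -- The first pass stacks up the suffixes, the second one pops them,
  -- shortest suffix first.
  foldrᴰ-foldlᴰ : ∀ f env l stack z →
    foldlᴰ (λ s → f (hd s ∙ (hd (hd (tl s)) ∙ tl (tl s)))) env (foldlᴰ push nil l stack) z ≡
    foldlᴰ (λ s → f (hd s ∙ (hd (hd (tl s)) ∙ tl (tl s)))) env stack (foldrᴰ f env l z)
  foldrᴰ-foldlᴰ f env nil     stack z = refl
  foldrᴰ-foldlᴰ f env (x ∙ l) stack z = foldrᴰ-foldlᴰ f env l ((x ∙ l) ∙ stack) z

  foldrᴾ : ∀ {f} → PT f → Growth f → ∀ {e l z} → PT e → PT l → PT z →
    PT (λ x → foldrᴰ f (e x) (l x) (z x))
  foldrᴾ {f} F (G , growth) {e} {l} {z} E L Z =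
    PT-cong (λ x → foldrᴰ-foldlᴰ f (e x) (l x) nil (z x))
      (foldlᴾ (F ∘ᴾ (hdᴾ idᴾ ∙ᴾ (hdᴾ (hdᴾ (tlᴾ idᴾ)) ∙ᴾ tlᴾ (tlᴾ idᴾ))))
        (G , λ env l acc → ≤-trans (growth env (hd l) acc)
          (+-monoʳ-≤ (size acc) (⟦⟧-mono G (s≤s (+-monoʳ-≤ (size env) (size-hd l))))))
        E (foldlᴾ pushᴾ push-growth nilᴾ L nilᴾ) Z)

  appendᴰ : Data → Data → Data
  appendᴰ = foldrᴰ (λ s → hd (hd (tl s)) ∙ tl (tl s)) nil

  -- The factor one in front of `size y` is what gives the step of `concatᴰ` additive growth.
  size-appendᴰ : ∀ x y → size (appendᴰ x y) ≤ size x + size y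
  size-appendᴰ nil     y = n≤1+n _
  size-appendᴰ (x ∙ l) y = s≤s (≤-trans (+-monoʳ-≤ (size x) (size-appendᴰ l y))
    (≤-reflexive (sym (+-assoc (size x) _ _))))

  appendᴾ : ∀ {f g} → PT f → PT g → PT (λ x → appendᴰ (f x) (g x))
  appendᴾ = foldrᴾ (hdᴾ (hdᴾ (tlᴾ idᴾ)) ∙ᴾ tlᴾ (tlᴾ idᴾ)) growth nilᴾ
    where
    growth : Growth (λ s → hd (hd (tl s)) ∙ tl (tl s))
    growth = var , λ env l acc → ≤-trans
      (s≤s (+-monoˡ-≤ _ (≤-trans (size-hd l) (m≤n+m _ (size env)))))
      (≤-reflexive (+-comm (size (env ∙ l)) (size acc)))

  concatᴰ : (Data → Data) → Data → Data → Data
  concatᴰ f env l = foldrᴰ (λ s → appendᴰ (f (hd s ∙ hd (tl s))) (tl (tl s))) env l nil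

  concatᴾ : ∀ {f e l} → PT f → PT e → PT l → PT (λ x → concatᴰ f (e x) (l x))
  concatᴾ {f} F E L = foldrᴾ (appendᴾ (F ∘ᴾ (hdᴾ idᴾ ∙ᴾ hdᴾ (tlᴾ idᴾ))) (tlᴾ (tlᴾ idᴾ))) growth E
    L nilᴾ
    where
    growth : Growth (λ s → appendᴰ (f (hd s ∙ hd (tl s))) (tl (tl s)))
    growth = PT.bound F , λ env l acc → ≤-trans (size-appendᴰ (f (env ∙ l)) acc)
      (≤-trans (+-monoˡ-≤ (size acc) (PT.output≤ F (env ∙ l))) (≤-reflexive (+-comm _ (size acc))))

-- A program for the reduction

module Program where

  open PolynomialTime
  open import Data.Integer.Base as ℤ using (∣_∣) renaming (+_ to pos)
  import Data.Integer.Properties as ℤ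
  open import Data.Integer.Tactic.RingSolver using () renaming (solve-∀ to solveℤ-∀)
  open import Data.Nat.Base using (_+_; _*_; _∸_; _≤_; z≤n; s≤s; s≤s⁻¹)
  open import Data.Nat.Binary.Base using (ℕᵇ; zero; 2[1+_]; 1+[2_]; double; pred; toℕ; fromℕ)
  open import Data.Nat.Binary.Properties using (toℕ-double; toℕ-pred; toℕ-fromℕ; toℕ-injective)
  open import Data.Nat.Coprimality using (Coprime)
  open import Data.Nat.Divisibility using (_∣_; ∣m+n∣m⇒∣n)
  open import Data.Nat.Properties
  open import Data.Nat.Tactic.RingSolver using (solve-∀)
  open import Data.Rational.Base using (mkℚ; ↥_)
  import Data.Rational.Unnormalised.Base as ℚᵘ
  import Data.Rational.Unnormalised.Properties as ℚᵘ

  -- Subtraction of binary numerals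

  -- The digits of `ℕᵇ` are 1 and 2. Since 2(1 + 2n) = 2(1 + 2n) with 2n to be computed recursively,
  -- digit 1 uses the accumulator; since 2(2 + 2n) = 2(1 + (1 + 2n)), digit 2 discards it.
  doubleStepᴰ : Data → Data
  doubleStepᴰ s = ifᴰ (hd (hd (tl s))) (nil ∙ tl (tl s)) (nil ∙ (encBool true ∙ tl (hd (tl s))))

  doubleᴰ : Data → Data
  doubleᴰ x = foldrᴰ doubleStepᴰ nil x nil

  constᴾ : ∀ d → PT (λ _ → d)
  constᴾ nil     = nilᴾ
  constᴾ (x ∙ y) = constᴾ x ∙ᴾ constᴾ y

  size-ifᴰ : ∀ b x y {n} → size x ≤ n → size y ≤ n → size (ifᴰ b x y) ≤ n
  size-ifᴰ nil     x y x≤n y≤n = y≤n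
  size-ifᴰ (_ ∙ _) x y x≤n y≤n = x≤n

  doubleᴾ : ∀ {f} → PT f → PT (λ x → doubleᴰ (f x))
  doubleᴾ F = foldrᴾ
    (ifᴾ (hdᴾ (hdᴾ (tlᴾ idᴾ))) (nilᴾ ∙ᴾ tlᴾ (tlᴾ idᴾ))
      (nilᴾ ∙ᴾ (constᴾ (encBool true) ∙ᴾ tlᴾ (hdᴾ (tlᴾ idᴾ)))))
    (con 6 ⊕ var , growth) nilᴾ F nilᴾ
    where
    growth : ∀ env l acc → size (doubleStepᴰ (env ∙ (l ∙ acc))) ≤ size acc + (6 + size (env ∙ l))
    growth env l acc = size-ifᴰ (hd l) _ _
      (≤-trans (≤-reflexive (+-comm 2 (size acc))) (+-monoʳ-≤ (size acc) (s≤s (s≤s z≤n))))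
      (≤-trans (+-monoʳ-≤ 6 (≤-trans (size-tl l) (≤-trans (m≤n+m _ (size env)) (n≤1+n _))))
        (m≤n+m _ (size acc)))

  -- The polynomial bound of `doubleᴾ` is too weak for `sub-growth`: there the accumulator itself is
  -- doubled, and it may grow only by a summand.
  size-doubleᴰ : ∀ x → size (doubleᴰ x) ≤ 5 + size x
  size-doubleᴰ nil = s≤s z≤n
  size-doubleᴰ (x ∙ l) = size-ifᴰ x _ _
    (≤-trans (+-monoʳ-≤ 2 (size-doubleᴰ l)) (+-monoʳ-≤ 6 (+-monoˡ-≤ (size l) (size>0 x))))
    (+-monoʳ-≤ 6 (m≤n+m _ (size x)))

  doubleᴰ-correct : ∀ n → doubleᴰ (encℕᵇ n) ≡ encℕᵇ (double n)
  doubleᴰ-correct zero     = refl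
  doubleᴰ-correct 2[1+ n ] = refl
  doubleᴰ-correct 1+[2 n ] = cong (nil ∙_) (doubleᴰ-correct n)

  -- Truncated subtraction has to decide x < y when it meets 2[1+ x ] and
  -- 1+[2 y ]; this version does not, and is a difference only if y ≤ x.
  sub : ℕᵇ → ℕᵇ → ℕᵇ
  sub zero     y        = zero
  sub 2[1+ x ] zero     = 2[1+ sub x zero ]
  sub 2[1+ x ] 2[1+ y ] = double (sub x y)
  sub 2[1+ x ] 1+[2 y ] = 1+[2 sub x y ]
  sub 1+[2 x ] zero     = 1+[2 sub x zero ]
  sub 1+[2 x ] 2[1+ y ] = pred (double (sub x y))
  sub 1+[2 x ] 1+[2 y ] = double (sub x y)

  toℕ-sub : ∀ x y → toℕ y ≤ toℕ x → toℕ (sub x y) + toℕ y ≡ toℕ x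
  toℕ-sub zero     zero     y≤x = refl
  toℕ-sub 2[1+ x ] zero     y≤x = trans (+-identityʳ _)
    (cong (λ n → 2 * suc n) (trans (sym (+-identityʳ _)) (toℕ-sub x zero z≤n)))
  toℕ-sub 1+[2 x ] zero     y≤x = trans (+-identityʳ _)
    (cong (λ n → suc (2 * n)) (trans (sym (+-identityʳ _)) (toℕ-sub x zero z≤n)))
  toℕ-sub 2[1+ x ] 2[1+ y ] y≤x rewrite toℕ-double (sub x y) =
    trans (regroup (toℕ (sub x y)) (toℕ y))
      (cong (λ n → 2 * suc n) (toℕ-sub x y (s≤s⁻¹ (*-cancelˡ-≤ {suc (toℕ y)} {suc (toℕ x)} 2 y≤x))))
    where
    regroup : ∀ s t → 2 * s + 2 * suc t ≡ 2 * suc (s + t)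
    regroup = solve-∀
  toℕ-sub 1+[2 x ] 1+[2 y ] (s≤s y≤x) rewrite toℕ-double (sub x y) =
    trans (regroup (toℕ (sub x y)) (toℕ y))
      (cong (λ n → suc (2 * n)) (toℕ-sub x y (*-cancelˡ-≤ {toℕ y} {toℕ x} 2 y≤x)))
    where
    regroup : ∀ s t → 2 * s + suc (2 * t) ≡ suc (2 * (s + t))
    regroup = solve-∀
  toℕ-sub 2[1+ x ] 1+[2 y ] y≤x =
    trans (regroup (toℕ (sub x y)) (toℕ y))
      (cong (λ n → 2 * suc n) (toℕ-sub x y (*-cancelˡ-≤ 2 (odd≤even (toℕ y) (toℕ x) y≤x))))
    where
    regroup : ∀ s t → suc (2 * s) + suc (2 * t) ≡ 2 * suc (s + t)
    regroup = solve-∀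
    odd≤even : ∀ m n → suc (2 * m) ≤ 2 * suc n → 2 * m ≤ 2 * n
    odd≤even m n p with s≤s q ← subst (suc (2 * m) ≤_) (*-suc 2 n) p with m ≤? n
    ... | yes m≤n = *-monoʳ-≤ 2 m≤n
    ... | no m≰n = ⊥-elim (1+n≰n (≤-trans (≤-reflexive (sym (*-suc 2 n)))
      (≤-trans (*-monoʳ-≤ 2 (≰⇒> m≰n)) q)))
  toℕ-sub 1+[2 x ] 2[1+ y ] (s≤s y≤x)
    rewrite toℕ-pred (double (sub x y)) | toℕ-double (sub x y)
    -- Here the hypothesis is 2 + 2y ≤ 1 + 2x, so y < x strictly. The difference is then positive,
    -- and `pred` does not truncate.
    with y<x ← *-cancelˡ-< 2 (toℕ y) (toℕ x) (≤-trans (≤-reflexive (sym (+-suc (toℕ y) _))) y≤x)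
    with toℕ (sub x y) | toℕ-sub x y (<⇒≤ y<x)
  ... | zero  | eq = ⊥-elim (<-irrefl eq y<x)
  ... | suc s | eq = trans (regroup s (toℕ y)) (cong (λ n → suc (2 * n)) eq)
    where
    regroup : ∀ s t → (s + 1 * suc s) + 2 * suc t ≡ suc (2 * (suc s + t))
    regroup = solve-∀

  sub-fromℕ : ∀ m n → n ≤ m → sub (fromℕ m) (fromℕ n) ≡ fromℕ (m ∸ n)
  sub-fromℕ m n n≤m = toℕ-injective (+-cancelʳ-≡ n _ _ (begin
    toℕ (sub (fromℕ m) (fromℕ n)) + n
      ≡⟨ cong (toℕ (sub (fromℕ m) (fromℕ n)) +_) (sym (toℕ-fromℕ n)) ⟩
    toℕ (sub (fromℕ m) (fromℕ n)) + toℕ (fromℕ n)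
      ≡⟨ toℕ-sub (fromℕ m) (fromℕ n) (subst₂ _≤_ (sym (toℕ-fromℕ n)) (sym (toℕ-fromℕ m)) n≤m) ⟩
    toℕ (fromℕ m)                                    ≡⟨ toℕ-fromℕ m ⟩
    m                                                ≡⟨ sym (m∸n+n≡m n≤m) ⟩
    m ∸ n + n                                        ≡⟨ cong (_+ n) (sym (toℕ-fromℕ (m ∸ n))) ⟩
    toℕ (fromℕ (m ∸ n)) + n                          ∎))
    where open ≡-Reasoning

  -- The state is the rest of the subtrahend and the stack of digit pairs;
  -- a missing digit of the subtrahend is nil, a digit d is d ∙ nil.
  zipStepᴰ : Data → Data
  zipStepᴰ s = tl y ∙ ((hd (hd (tl s)) ∙ ifᴰ y (hd y ∙ nil) nil) ∙ tl (tl (tl s)))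
    where y = hd (tl (tl s))

  -- The stack has the most significant pair on top, so a left fold over it unwinds the recursion of
  -- `sub`; the nested tests are the clauses of `sub`. A doubled number is zero or starts with digit
  -- 2, hence its predecessor only changes that digit to 1.
  subStepᴰ : Data → Data
  subStepᴰ s =
    ifᴰ e
      (ifᴰ d
        (ifᴰ (hd e) (doubleᴰ r) (ifᴰ (doubleᴰ r) (encBool true ∙ tl (doubleᴰ r)) nil))
        (ifᴰ (hd e) (encBool true ∙ r) (doubleᴰ r)))
      (d ∙ r)
    where
    d = hd (hd (hd (tl s)))
    e = tl (hd (hd (tl s)))
    r = tl (tl s)

  subᴰ : Data → Data → Data
  subᴰ x y = foldlᴰ subStepᴰ nil (tl (foldlᴰ zipStepᴰ nil x (y ∙ nil))) nil

  subᴾ : ∀ {f g} → PT f → PT g → PT (λ x → subᴰ (f x) (g x))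
  subᴾ F G = foldlᴾ subStepᴾ (con 8 ⊕ var , sub-growth) nilᴾ
    (tlᴾ (foldlᴾ zipStepᴾ (con 8 ⊕ var , zip-growth) nilᴾ F (G ∙ᴾ nilᴾ))) nilᴾ
    where
    zipStepᴾ : PT zipStepᴰ
    zipStepᴾ = tlᴾ Y ∙ᴾ ((hdᴾ (hdᴾ (tlᴾ idᴾ)) ∙ᴾ ifᴾ Y (hdᴾ Y ∙ᴾ nilᴾ) nilᴾ) ∙ᴾ tlᴾ (tlᴾ (tlᴾ idᴾ)))
      where
      Y : PT (λ s → hd (tl (tl s)))
      Y = hdᴾ (tlᴾ (tlᴾ idᴾ))
    subStepᴾ : PT subStepᴰ
    subStepᴾ = ifᴾ E
        (ifᴾ D
          (ifᴾ (hdᴾ E) (doubleᴾ R) (ifᴾ (doubleᴾ R) (constᴾ (encBool true) ∙ᴾ tlᴾ (doubleᴾ R))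
            nilᴾ))
          (ifᴾ (hdᴾ E) (constᴾ (encBool true) ∙ᴾ R) (doubleᴾ R)))
        (D ∙ᴾ R)
      where
      D : PT (λ s → hd (hd (hd (tl s))))
      D = hdᴾ (hdᴾ (hdᴾ (tlᴾ idᴾ)))
      E : PT (λ s → tl (hd (hd (tl s))))
      E = tlᴾ (hdᴾ (hdᴾ (tlᴾ idᴾ)))
      R : PT (λ s → tl (tl s))
      R = tlᴾ (tlᴾ idᴾ)
    zip-growth : ∀ env l acc → size (zipStepᴰ (env ∙ (l ∙ acc))) ≤ size acc + (8 + size (env ∙ l))
    -- `Growth` speaks of all trees, so accumulators that encode no state have to be covered as
    -- well.
    zip-growth env l nil = begin
      size (zipStepᴰ (env ∙ (l ∙ nil)))  ≡⟨ regroup (size (hd l)) ⟩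
      6 + size (hd l)
        ≤⟨ +-mono-≤ {6} {9} (s≤s (s≤s (s≤s (s≤s (s≤s (s≤s z≤n))))))
          (≤-trans (size-hd l) (≤-trans (m≤n+m _ (size env)) (n≤1+n _))) ⟩
      9 + size (env ∙ l)                 ∎
      where
      open ≤-Reasoning
      regroup : ∀ n → suc (1 + suc (suc (n + 1) + 1)) ≡ 6 + n
      regroup = solve-∀
    zip-growth env l (nil ∙ out) = begin
      size (zipStepᴰ (env ∙ (l ∙ (nil ∙ out))))  ≡⟨ regroup (size (hd l)) (size out) ⟩
      suc (suc (size out)) + (3 + size (hd l))
        ≤⟨ +-monoʳ-≤ (suc (suc (size out)))
          (+-mono-≤ {3} {8} (s≤s (s≤s (s≤s z≤n)))
            (≤-trans (size-hd l) (≤-trans (m≤n+m _ (size env)) (n≤1+n _)))) ⟩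
      size (nil ∙ out) + (8 + size (env ∙ l))    ∎
      where
      open ≤-Reasoning
      regroup : ∀ n o → suc (1 + suc (suc (n + 1) + o)) ≡ suc (suc o) + (3 + n)
      regroup = solve-∀
    zip-growth env l ((c ∙ y) ∙ out) = begin
      size (zipStepᴰ (env ∙ (l ∙ ((c ∙ y) ∙ out))))
        ≡⟨ regroup (size c) (size y) (size (hd l)) (size out) ⟩
      size ((c ∙ y) ∙ out) + (3 + size (hd l))
        ≤⟨ +-monoʳ-≤ (size ((c ∙ y) ∙ out))
          (+-mono-≤ {3} {8} (s≤s (s≤s (s≤s z≤n)))
            (≤-trans (size-hd l) (≤-trans (m≤n+m _ (size env)) (n≤1+n _)))) ⟩
      size ((c ∙ y) ∙ out) + (8 + size (env ∙ l))     ∎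
      where
      open ≤-Reasoning
      regroup : ∀ c y n o → suc (y + suc (suc (n + suc (c + 1)) + o)) ≡
        suc (suc (c + y) + o) + (3 + n)
      regroup = solve-∀
    sub-growth : ∀ env l acc → size (subStepᴰ (env ∙ (l ∙ acc))) ≤ size acc + (8 + size (env ∙ l))
    sub-growth env l r =
      size-ifᴰ (tl (hd l)) _ _
        (size-ifᴰ (hd (hd l)) _ _
          (size-ifᴰ (hd (tl (hd l))) _ _ double≤
            (size-ifᴰ (doubleᴰ r) _ _
              (≤-trans (+-monoʳ-≤ 4 (≤-trans (size-tl (doubleᴰ r)) (size-doubleᴰ r)))
                (≤-trans (≤-reflexive (+-comm 9 (size r)))
                  (+-monoʳ-≤ (size r) (+-monoʳ-≤ 8 (s≤s z≤n)))))
              (≤-trans (s≤s z≤n) (m≤n+m _ (size r)))))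
          (size-ifᴰ (hd (tl (hd l))) _ _ (≤-trans (≤-reflexive (+-comm 4 (size r)))
            (+-monoʳ-≤ (size r) (s≤s (s≤s (s≤s (s≤s z≤n)))))) double≤))
        (≤-trans (s≤s (+-monoˡ-≤ (size r)
          (≤-trans (size-hd (hd l)) (≤-trans (size-hd l)
            (≤-trans (m≤n+m _ (size env)) (n≤1+n _))))))
          (≤-trans (≤-reflexive (+-comm (suc (size (env ∙ l))) (size r)))
            (+-monoʳ-≤ (size r) (s≤s (m≤n+m _ 7)))))
      where
      double≤ : size (doubleᴰ r) ≤ size r + (8 + size (env ∙ l))
      double≤ = ≤-trans (size-doubleᴰ r)
        (≤-trans (≤-reflexive (+-comm 5 (size r)))
          (+-monoʳ-≤ (size r) (s≤s (s≤s (s≤s (s≤s (s≤s z≤n)))))))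

  subᴰ-correct : ∀ x y → subᴰ (encℕᵇ x) (encℕᵇ y) ≡ encℕᵇ (sub x y)
  subᴰ-correct x y = go x y nil
    where
    pred-double : ∀ n → ifᴰ (encℕᵇ (double n)) (encBool true ∙ tl (encℕᵇ (double n))) nil ≡
      encℕᵇ (pred (double n))
    pred-double zero     = refl
    pred-double 2[1+ n ] = refl
    pred-double 1+[2 n ] = refl
    -- Generalised over the stack `out` of earlier pairs: the pairs pushed afterwards lie above it
    -- and are evaluated first, leaving `sub x y` as the accumulator.
    go : ∀ x y out →
      foldlᴰ subStepᴰ nil (tl (foldlᴰ zipStepᴰ nil (encℕᵇ x) (encℕᵇ y ∙ out))) nil ≡
      foldlᴰ subStepᴰ nil out (encℕᵇ (sub x y))
    go zero     y        out = refl
    go 2[1+ x ] zero     out = go x zero _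
    go 2[1+ x ] 2[1+ y ] out = trans (go x y _)
      (cong (foldlᴰ subStepᴰ nil out) (doubleᴰ-correct (sub x y)))
    go 2[1+ x ] 1+[2 y ] out = go x y _
    go 1+[2 x ] zero     out = go x zero _
    go 1+[2 x ] 2[1+ y ] out = trans (go x y _) (cong (foldlᴰ subStepᴰ nil out)
      (trans (cong (λ z → ifᴰ z (encBool true ∙ tl z) nil) (doubleᴰ-correct (sub x y)))
        (pred-double (sub x y))))
    go 1+[2 x ] 1+[2 y ] out = trans (go x y _)
      (cong (foldlᴰ subStepᴰ nil out) (doubleᴰ-correct (sub x y)))

  -- The coefficient 1 - p in lowest terms

  -- A common divisor of d - n and d divides n. So (d - n)/d is already in lowest terms, and the
  -- program never has to compute a gcd.
  coprime-∸ : ∀ {m n} → n ≤ m → Coprime n m → Coprime (m ∸ n) m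
  coprime-∸ n≤m c {e} (e∣m∸n , e∣m) =
    c (∣m+n∣m⇒∣n (subst (e ∣_) (sym (m∸n+n≡m n≤m)) e∣m) e∣m∸n , e∣m)

  -- Subtraction on ℚ normalises by a gcd that is stuck for variables. Among unnormalised fractions
  -- the claim is a cross-multiplied ring identity, and normal forms are determined by their
  -- fraction.
  1-mkℚ : ∀ n d-1 .(c : Coprime n (suc d-1)) .(c′ : Coprime (suc d-1 ∸ n) (suc d-1)) → n ≤
    suc d-1 → 1ℚ ℚ.- mkℚ (pos n) d-1 c ≡ mkℚ (pos (suc d-1 ∸ n)) d-1 c′
  1-mkℚ n d-1 c c′ n≤d = ℚ.toℚᵘ-injective (ℚᵘ.≃-trans (ℚ.toℚᵘ-homo-+ 1ℚ (ℚ.- p))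
    (ℚᵘ.≃-trans (ℚᵘ.+-congʳ (ℚ.toℚᵘ 1ℚ) (ℚ.toℚᵘ-homo‿- p)) (ℚᵘ.*≡* (begin
      (pos 1 ℤ.* pos d ℤ.+ (ℤ.- (pos n)) ℤ.* pos 1) ℤ.* pos d   ≡⟨ regroup (pos d) (pos n) ⟩
      (pos d ℤ.- pos n) ℤ.* (pos 1 ℤ.* pos d)
        ≡⟨ cong (ℤ._* (pos 1 ℤ.* pos d)) (trans (ℤ.m-n≡m⊖n d n) (ℤ.⊖-≥ n≤d)) ⟩
      pos (d ∸ n) ℤ.* (pos 1 ℤ.* pos d)                      ∎))))
    where
    open ≡-Reasoning
    d = suc d-1
    p = mkℚ (pos n) d-1 c
    regroup : ∀ d n → (pos 1 ℤ.* d ℤ.+ (ℤ.- n) ℤ.* pos 1) ℤ.* d ≡ (d ℤ.- n) ℤ.* (pos 1 ℤ.* d)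
    regroup = solveℤ-∀

  encCoefficient-1- : ∀ p → 0ℚ ℚ.≤ p → p ℚ.≤ 1ℚ →
    subᴰ (tl (encCoefficient p)) (hd (encCoefficient p)) ∙ tl (encCoefficient p) ≡
      encCoefficient (1ℚ ℚ.- p)
  encCoefficient-1- (mkℚ (pos n) d-1 c) 0≤p (ℚ.*≤* p≤1) = begin
    subᴰ (encℕᵇ (fromℕ d)) (encℕᵇ (fromℕ n)) ∙ encℕᵇ (fromℕ d)
      ≡⟨ cong (_∙ encℕᵇ (fromℕ d)) (trans (subᴰ-correct (fromℕ d) (fromℕ n))
        (cong encℕᵇ (sub-fromℕ d n n≤d))) ⟩
    encCoefficient (mkℚ (pos (d ∸ n)) d-1 (coprime-∸ n≤d c))
      ≡⟨ cong encCoefficient (sym (1-mkℚ n d-1 c (coprime-∸ n≤d c) n≤d)) ⟩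
    encCoefficient (1ℚ ℚ.- mkℚ (pos n) d-1 c)                    ∎
    where
    open ≡-Reasoning
    d = suc d-1
    n≤d : n ≤ d
    n≤d = ℤ.drop‿+≤+ (subst₂ ℤ._≤_ (ℤ.*-identityʳ (pos n)) (ℤ.*-identityˡ (pos d)) p≤1)
  encCoefficient-1- (mkℚ (ℤ.-[1+ n ]) d-1 c) (ℚ.*≤* ()) p≤1

  -- The numeral zero is encoded as `nil`, so the machine's own test on the numerator decides p = 0,
  -- with the branches exchanged.
  ifᴰ-numerator : ∀ p x y → ifᴰ (hd (encCoefficient p)) x y ≡ (ifᵇ does (p ℚ.≟ 0ℚ) then y else x)
  ifᴰ-numerator p x y with p ℚ.≟ 0ℚ
  ... | yes refl = refl
  ... | no p≢0 with fromℕ ∣ ↥ p ∣ | toℕ-fromℕ ∣ ↥ p ∣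
  ...   | zero     | eq = ⊥-elim (p≢0 (ℚ.↥p≡0⇒p≡0 p (ℤ.∣i∣≡0⇒i≡0 (sym eq))))
  ...   | 2[1+ _ ] | eq = refl
  ...   | 1+[2 _ ] | eq = refl

  -- Names printed from suffixes

  -- The encoded list itself serves as the numeral: one digit is emitted per entry, whatever the
  -- entries are.
  unaryᴰ : Data → Data → Data
  unaryᴰ l z = foldrᴰ (λ s → encBool true ∙ tl (tl s)) nil l (encBool false ∙ z)

  unaryᴾ : ∀ {f g} → PT f → PT g → PT (λ x → unaryᴰ (f x) (g x))
  unaryᴾ F G = foldrᴾ (constᴾ (encBool true) ∙ᴾ tlᴾ (tlᴾ idᴾ))
    (con 4 , λ _ _ acc → ≤-reflexive (+-comm 4 (size acc))) nilᴾ F (constᴾ (encBool false) ∙ᴾ G)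

  unaryᴰ-correct : ∀ {A : Set} (enc : A → Data) l e →
    unaryᴰ (encList enc l) (encElement e) ≡ encElement (unary (length l) e)
  unaryᴰ-correct enc []      e = refl
  unaryᴰ-correct enc (x ∷ l) e = cong (encBool true ∙_) (unaryᴰ-correct enc l e)

  -- Three indices are given by lists, `nil` being index 0; passing a suffix with its head still on
  -- yields the successors in `groupSets`, `tradeoffSets` and `slot`.
  freshᴰ : Data → Data → Data → ℕ → Data
  freshᴰ gs is js k = encBool true ∙ unaryᴰ gs (unaryᴰ is (unaryᴰ js (encElement (unary k []))))

  freshᴾ : ∀ {f g h} → PT f → PT g → PT h → ∀ k → PT (λ x → freshᴰ (f x) (g x) (h x) k)
  freshᴾ F G H k = constᴾ (encBool true) ∙ᴾ unaryᴾ F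
    (unaryᴾ G (unaryᴾ H (constᴾ (encElement (unary k [])))))

  module _ {A B C : Set} (encA : A → Data) (encB : B → Data) (encC : C → Data) where

    opaque
      unfolding fresh

      freshᴰ-correct : ∀ gs is js k →
        freshᴰ (encList encA gs) (encList encB is) (encList encC js) k ≡
        encElement (fresh (length gs) (length is) (length js) k)
      freshᴰ-correct gs is js k = cong (encBool true ∙_) (begin
        unaryᴰ (encList encA gs) (unaryᴰ (encList encB is)
          (unaryᴰ (encList encC js) (encElement (unary k []))))
          ≡⟨ cong (λ e → unaryᴰ (encList encA gs) (unaryᴰ (encList encB is) e))
            (unaryᴰ-correct encC js _) ⟩
        unaryᴰ (encList encA gs) (unaryᴰ (encList encB is)
          (encElement (unary (length js) (unary k []))))
          ≡⟨ cong (unaryᴰ (encList encA gs)) (unaryᴰ-correct encB is _) ⟩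
        unaryᴰ (encList encA gs) (encElement (unary (length is) (unary (length js) (unary k []))))
          ≡⟨ unaryᴰ-correct encA gs _ ⟩
        encElement (unary (length gs) (unary (length is) (unary (length js) (unary k [])))) ∎)
        where open ≡-Reasoning

  appendᴰ-correct : ∀ {A : Set} (enc : A → Data) xs ys →
    appendᴰ (encList enc xs) (encList enc ys) ≡ encList enc (xs ++ ys)
  appendᴰ-correct enc []       ys = refl
  appendᴰ-correct enc (x ∷ xs) ys = cong (enc x ∙_) (appendᴰ-correct enc xs ys)

  module _ {A B : Set} (encA : A → Data) (encB : B → Data) (f : Data → Data) (env : Data)
    {P : A → Set}
    {g : A → List A → List B}
    (correct : ∀ x xs → P x → f (env ∙ encList encA (x ∷ xs)) ≡ encList encB (g x xs)) where

    concatᴰ-correct : ∀ {xs} → All P xs → concatᴰ f env (encList encA xs) ≡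
      encList encB (concatSuffixes g xs)
    concatᴰ-correct []             = refl
    concatᴰ-correct {x ∷ xs} (px ∷ pxs) =
      trans (cong₂ appendᴰ (correct x xs px) (concatᴰ-correct pxs))
        (appendᴰ-correct encB (g x xs) (concatSuffixes g xs))

  -- The tradeoff sets, computed on encodings

  encSets : List Tradeoff → Data
  encSets = encList encTradeoff

  singleᴰ : Data → Data
  singleᴰ e = (encCoefficient 1ℚ ∙ e) ∙ nil

  singleᴾ : ∀ {f} → PT f → PT (λ x → singleᴰ (f x))
  singleᴾ F = (constᴾ (encCoefficient 1ℚ) ∙ᴾ F) ∙ᴾ nilᴾ

  complementᴰ : Data → Data
  complementᴰ c = subᴰ (tl c) (hd c) ∙ tl c

  complementᴾ : ∀ {f} → PT f → PT (λ x → complementᴰ (f x))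
  complementᴾ F = subᴾ (tlᴾ F) (hdᴾ F) ∙ᴾ tlᴾ F

  spreadᴰ : Data → Data → Data → Data
  spreadᴰ c y z = (c ∙ y) ∙ ifᴰ (hd (complementᴰ c)) ((complementᴰ c ∙ z) ∙ nil) nil

  spreadᴾ : ∀ {f g h} → PT f → PT g → PT h → PT (λ x → spreadᴰ (f x) (g x) (h x))
  spreadᴾ F G H = (F ∙ᴾ G) ∙ᴾ ifᴾ (hdᴾ (complementᴾ F)) ((complementᴾ F ∙ᴾ H) ∙ᴾ nilᴾ) nilᴾ

  spreadᴰ-correct : ∀ {p} y z → 0ℚ ℚ.≤ p → p ℚ.≤ 1ℚ →
    spreadᴰ (encCoefficient p) (encElement y) (encElement z) ≡ encTradeoff (spread p y z)
  spreadᴰ-correct {p} y z 0≤p p≤1 = cong ((encCoefficient p ∙ encElement y) ∙_)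
    (trans (cong (λ c → ifᴰ (hd c) ((c ∙ encElement z) ∙ nil) nil) (encCoefficient-1- p 0≤p p≤1))
      (trans (ifᴰ-numerator (1ℚ ℚ.- p) _ _) (enc-if (does (1ℚ ℚ.- p ℚ.≟ 0ℚ)))))
    where
    enc-if : ∀ b → (ifᵇ b then nil else ((encCoefficient (1ℚ ℚ.- p) ∙ encElement z) ∙ nil)) ≡
      encTradeoff (ifᵇ b then [] else (1ℚ ℚ.- p , z) ∷ [])
    enc-if true  = refl
    enc-if false = refl

  module _ (gs is js b : Data) (c : Data) where

    fragmentSetsᴰ′ : Data
    fragmentSetsᴰ′ = ifᴰ (hd c)
      ((spreadᴰ c (freshᴰ gs is nil 1) (freshᴰ gs is js 1) ∙ (singleᴰ (freshᴰ gs is js 0) ∙ nil)) ∙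
       ((singleᴰ (freshᴰ gs is js 0) ∙ (spreadᴰ c (encBool false ∙ b) (freshᴰ gs is js 2) ∙ nil))
         ∙ nil))
      nil

  fragmentSetsᴰ : Data → Data
  fragmentSetsᴰ s = fragmentSetsᴰ′ (hd (hd s)) (tl (hd s)) (tl s) (tl (hd (tl s))) (hd (hd (tl s)))

  fragmentSetsᴾ : PT fragmentSetsᴰ
  fragmentSetsᴾ = ifᴾ (hdᴾ C)
      ((spreadᴾ C (freshᴾ Gs Is nilᴾ 1) (freshᴾ Gs Is Js 1) ∙ᴾ
        (singleᴾ (freshᴾ Gs Is Js 0) ∙ᴾ nilᴾ)) ∙ᴾ
       ((singleᴾ (freshᴾ Gs Is Js 0) ∙ᴾ
         (spreadᴾ C (constᴾ (encBool false) ∙ᴾ tlᴾ (hdᴾ (tlᴾ idᴾ))) (freshᴾ Gs Is Js 2) ∙ᴾ nilᴾ))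
           ∙ᴾ nilᴾ))
      nilᴾ
    where
    Gs : PT (λ s → hd (hd s))
    Gs = hdᴾ (hdᴾ idᴾ)
    Is : PT (λ s → tl (hd s))
    Is = tlᴾ (hdᴾ idᴾ)
    Js : PT tl
    Js = tlᴾ idᴾ
    C : PT (λ s → hd (hd (tl s)))
    C = hdᴾ (hdᴾ (tlᴾ idᴾ))

  tradeoffSetsᴰ : Data → Data
  tradeoffSetsᴰ s =
    (singleᴰ (freshᴰ (hd s) (tl s) nil 0) ∙
     (singleᴰ (freshᴰ (hd s) (tl s) nil 1) ∙
      (singleᴰ (freshᴰ (hd s) (tl (tl s)) nil 0) ∙ nil))) ∙
    concatᴰ fragmentSetsᴰ s (hd (tl s))

  tradeoffSetsᴾ : PT tradeoffSetsᴰ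
  tradeoffSetsᴾ =
    (singleᴾ (freshᴾ (hdᴾ idᴾ) (tlᴾ idᴾ) nilᴾ 0) ∙ᴾ
     (singleᴾ (freshᴾ (hdᴾ idᴾ) (tlᴾ idᴾ) nilᴾ 1) ∙ᴾ
      (singleᴾ (freshᴾ (hdᴾ idᴾ) (tlᴾ (tlᴾ idᴾ)) nilᴾ 0) ∙ᴾ nilᴾ))) ∙ᴾ
    concatᴾ fragmentSetsᴾ idᴾ (hdᴾ (tlᴾ idᴾ))

  groupSetsᴰ : Data → Data
  groupSetsᴰ s =
    (singleᴰ (freshᴰ (tl s) nil nil 0) ∙ nil) ∙ ((singleᴰ (freshᴰ (tl s) (hd (tl s)) nil 0) ∙ nil) ∙
    concatᴰ tradeoffSetsᴰ (tl s) (hd (tl s)))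

  groupSetsᴾ : PT groupSetsᴰ
  groupSetsᴾ =
    (singleᴾ (freshᴾ (tlᴾ idᴾ) nilᴾ nilᴾ 0) ∙ᴾ nilᴾ) ∙ᴾ
    ((singleᴾ (freshᴾ (tlᴾ idᴾ) (hdᴾ (tlᴾ idᴾ)) nilᴾ 0) ∙ᴾ nilᴾ) ∙ᴾ
    concatᴾ tradeoffSetsᴾ (tlᴾ idᴾ) (hdᴾ (tlᴾ idᴾ)))

  elementᴰ tradeoffElementsᴰ setElementsᴰ elementsOfᴰ : Data → Data
  elementᴰ          s = tl (hd (tl s)) ∙ nil
  tradeoffElementsᴰ s = concatᴰ elementᴰ nil (hd (tl s))
  setElementsᴰ      s = concatᴰ tradeoffElementsᴰ nil (hd (tl s))
  elementsOfᴰ         = concatᴰ setElementsᴰ nil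

  elementsOfᴾ : ∀ {f} → PT f → PT (λ x → elementsOfᴰ (f x))
  elementsOfᴾ = concatᴾ (concatᴾ (concatᴾ (tlᴾ (hdᴾ (tlᴾ idᴾ)) ∙ᴾ nilᴾ) nilᴾ (hdᴾ (tlᴾ idᴾ))) nilᴾ
    (hdᴾ (tlᴾ idᴾ))) nilᴾ

  reduceᴰ : Data → Data
  reduceᴰ x = elementsOfᴰ (concatᴰ groupSetsᴰ nil (tl x)) ∙ concatᴰ groupSetsᴰ nil (tl x)

  reduceᴾ : PT reduceᴰ
  reduceᴾ = elementsOfᴾ (concatᴾ groupSetsᴾ nilᴾ (tlᴾ idᴾ)) ∙ᴾ concatᴾ groupSetsᴾ nilᴾ (tlᴾ idᴾ)

  fragmentSetsᴰ-correct : ∀ gs is f fs → Bounded f →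
    fragmentSetsᴰ ((encList encSets gs ∙ encSets is) ∙ encTradeoff (f ∷ fs)) ≡
    encList encSets (fragmentSets (length gs) (length is) f fs)
  fragmentSetsᴰ-correct gs is (p , b) fs (0≤p , p≤1)
    rewrite freshᴰ-correct encSets encTradeoff encFragment gs is [] 1
          | freshᴰ-correct encSets encTradeoff encFragment gs is ((p , b) ∷ fs) 0
          | freshᴰ-correct encSets encTradeoff encFragment gs is ((p , b) ∷ fs) 1
          | freshᴰ-correct encSets encTradeoff encFragment gs is ((p , b) ∷ fs) 2
          | spreadᴰ-correct (selector (length gs) (length is))
            (sink (length gs) (length is) (length fs) 0) 0≤p p≤1
          | spreadᴰ-correct (original b) (sink (length gs) (length is) (length fs) 1) 0≤p p≤1
    = trans (ifᴰ-numerator p _ _) (enc-if (does (p ℚ.≟ 0ℚ)))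
    where
    enc-if : ∀ b {x} → (ifᵇ b then nil else encList encSets x) ≡
      encList encSets (ifᵇ b then [] else x)
    enc-if true  = refl
    enc-if false = refl

  tradeoffSetsᴰ-correct : ∀ gs t ts → All Bounded t →
    tradeoffSetsᴰ (encList encSets gs ∙ encSets (t ∷ ts)) ≡
      encList encSets (tradeoffSets (length gs) t ts)
  tradeoffSetsᴰ-correct gs t ts bounded
    rewrite freshᴰ-correct encSets encTradeoff encFragment gs (t ∷ ts) [] 0
          | freshᴰ-correct encSets encTradeoff encFragment gs (t ∷ ts) [] 1
          | freshᴰ-correct encSets encTradeoff encFragment gs ts [] 0
    = cong₂ _∙_ refl (concatᴰ-correct encFragment encSets fragmentSetsᴰ _
      (fragmentSetsᴰ-correct gs (t ∷ ts)) bounded)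

  groupSetsᴰ-correct : ∀ ts tss → All (All Bounded) ts →
    groupSetsᴰ (nil ∙ encList encSets (ts ∷ tss)) ≡ encList encSets (groupSets ts tss)
  groupSetsᴰ-correct ts tss bounded
    rewrite freshᴰ-correct encSets encTradeoff encFragment (ts ∷ tss) ts [] 0
          | freshᴰ-correct encSets encTradeoff encFragment (ts ∷ tss) [] [] 0
    = cong₂ _∙_ refl (cong₂ _∙_ refl
      (concatᴰ-correct encTradeoff encSets tradeoffSetsᴰ _ (tradeoffSetsᴰ-correct (ts ∷ tss))
        bounded))

  elementsOfᴰ-correct : ∀ tss → elementsOfᴰ (encList encSets tss) ≡
    encList encElement (elementsOf tss)
  elementsOfᴰ-correct tss =
    concatᴰ-correct encSets encElement setElementsᴰ nil (λ ts _ _ →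
      concatᴰ-correct encTradeoff encElement tradeoffElementsᴰ nil (λ t _ _ →
        concatᴰ-correct encFragment encElement elementᴰ nil (λ f _ _ → refl)
          (All.universal (λ _ → tt) t))
        (All.universal (λ _ → tt) ts))
      (All.universal (λ _ → tt) tss)

  reduceᴰ-correct : ∀ b tss → All (All (All Bounded)) tss →
    reduceᴰ (b ∙ encList encSets tss) ≡
    encList encElement (elementsOf (reducedSets tss)) ∙ encList encSets (reducedSets tss)
  reduceᴰ-correct b tss bounded =
    trans (cong (λ x → elementsOfᴰ x ∙ x)
      (concatᴰ-correct encSets encSets groupSetsᴰ nil groupSetsᴰ-correct bounded))
      (cong (_∙ encList encSets (reducedSets tss)) (elementsOfᴰ-correct (reducedSets tss)))

-- Correctness of the reduction

module Correctness where

  open PolynomialTime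
  open Program
  open import Data.Fin.Base using (Fin; zero; suc)
  open import Data.Integer.Base using (+≤+; +<+)
  open import Data.List.Membership.Propositional.Properties using (∈-lookup; ∈-++⁺ˡ; ∈-++⁺ʳ)
  import Data.List.Properties as List
  open import Data.List.Relation.Binary.Sublist.Propositional using (_⊆_; []; _∷_; _∷ʳ_; ⊆-refl; minimum)
  import Data.List.Relation.Binary.Sublist.Propositional.Properties as ⊆
  import Data.List.Relation.Unary.All.Properties as All
  open import Data.List.Relation.Unary.Any as Any using (here; there)
  import Data.Nat.Base as ℕ
  import Data.Nat.Properties as ℕ
  open import Data.Rational.Base using (_+_; _-_; -_; _≤_; _<_; *≤*; *<*)
  open import Data.Rational.Properties
  open import Data.Sum.Base using (_⊎_; inj₁; inj₂)
  open import Function.Bundles using (mk⇔)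

  -- Loads and capacity

  0≤1 : 0ℚ ≤ 1ℚ
  0≤1 = *≤* (+≤+ ℕ.z≤n)

  p≢0⇒0<p : ∀ {p} → 0ℚ ≤ p → p ≢ 0ℚ → 0ℚ < p
  p≢0⇒0<p 0≤p p≢0 = ≰⇒> λ p≤0 → p≢0 (≤-antisym p≤0 0≤p)

  1+p≰1 : ∀ {p} → 0ℚ < p → ¬ (1ℚ + p ≤ 1ℚ)
  1+p≰1 {p} 0<p 1+p≤1 =
    <-irrefl refl (<-≤-trans (subst (_< 1ℚ + p) (+-identityʳ 1ℚ) (+-monoʳ-< 1ℚ 0<p)) 1+p≤1)

  p+[1-p]≡1 : ∀ p → p + (1ℚ - p) ≡ 1ℚ
  p+[1-p]≡1 p = begin
    p + (1ℚ - p)  ≡⟨ cong (p +_) (+-comm 1ℚ (- p)) ⟩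
    p + (- p + 1ℚ) ≡⟨ sym (+-assoc p (- p) 1ℚ) ⟩
    (p - p) + 1ℚ  ≡⟨ cong (_+ 1ℚ) (+-inverseʳ p) ⟩
    0ℚ + 1ℚ       ≡⟨ +-identityˡ 1ℚ ⟩
    1ℚ            ∎
    where open ≡-Reasoning

  0≤1-p : ∀ {p} → p ≤ 1ℚ → 0ℚ ≤ 1ℚ - p
  0≤1-p {p} p≤1 = subst (_≤ 1ℚ - p) (+-inverseʳ p) (+-monoˡ-≤ (- p) p≤1)

  1-p≤1 : ∀ {p} → 0ℚ ≤ p → 1ℚ - p ≤ 1ℚ
  1-p≤1 {p} 0≤p = ≤-trans (≤-reflexive (sym (+-identityˡ _)))
    (≤-trans (+-monoˡ-≤ (1ℚ - p) 0≤p) (≤-reflexive (p+[1-p]≡1 p)))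

  p≤q+p : ∀ {p q} → 0ℚ ≤ q → p ≤ q + p
  p≤q+p {p} {q} 0≤q = subst (_≤ q + p) (+-identityˡ p) (+-monoˡ-≤ p 0≤q)

  load-hit : ∀ {p e e′} fs → e′ ≡ e → load e ((p , e′) ∷ fs) ≡ p + load e fs
  load-hit {p} {e} fs refl = cong (λ xs → sumℚ (map proj₁ xs))
    (List.filter-accept (λ f → proj₂ f ≟ᴱ e) {x = p , e} {fs} refl)

  load-miss : ∀ {p e e′} fs → e′ ≢ e → load e ((p , e′) ∷ fs) ≡ load e fs
  load-miss {p} {e} {e′} fs e′≢e =
    cong (λ xs → sumℚ (map proj₁ xs))
      (List.filter-reject (λ f → proj₂ f ≟ᴱ e) {x = p , e′} {fs} e′≢e)

  -- Bundles the decision with its effect on every tail, so that one case split serves loads of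
  -- several lists at once.
  load-∷ : ∀ e p e′ →
    (e′ ≡ e × ∀ fs → load e ((p , e′) ∷ fs) ≡ p + load e fs) ⊎
    (e′ ≢ e × ∀ fs → load e ((p , e′) ∷ fs) ≡ load e fs)
  load-∷ e p e′ with e′ ≟ᴱ e
  ... | yes e′≡e = inj₁ (e′≡e , λ fs → refl)
  ... | no  e′≢e = inj₂ (e′≢e , λ fs → refl)

  load-++ : ∀ e fs gs → load e (fs ++ gs) ≡ load e fs + load e gs
  load-++ e []              gs = sym (+-identityˡ _)
  load-++ e ((p , e′) ∷ fs) gs with load-∷ e p e′
  ... | inj₁ (_ , eq) = begin
    load e ((p , e′) ∷ fs ++ gs)           ≡⟨ eq (fs ++ gs) ⟩
    p + load e (fs ++ gs)                  ≡⟨ cong (p +_) (load-++ e fs gs) ⟩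
    p + (load e fs + load e gs)            ≡⟨ sym (+-assoc p _ _) ⟩
    p + load e fs + load e gs              ≡⟨ cong (_+ load e gs) (sym (eq fs)) ⟩
    load e ((p , e′) ∷ fs) + load e gs     ∎
    where open ≡-Reasoning
  ... | inj₂ (_ , eq) = trans (eq (fs ++ gs))
    (trans (load-++ e fs gs) (cong (_+ load e gs) (sym (eq fs))))

  load-unused : ∀ {e fs} → All (λ f → proj₂ f ≢ e) fs → load e fs ≡ 0ℚ
  load-unused []                    = refl
  load-unused {e} {_ ∷ fs} (e′≢e ∷ unused) = trans (load-miss fs e′≢e) (load-unused unused)

  NonNeg : List Fragment → Set
  NonNeg = All λ f → 0ℚ ≤ proj₁ f

  load-⊆ : ∀ e {fs gs} → NonNeg gs → fs ⊆ gs → load e fs ≤ load e gs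
  load-⊆ e nn [] = ≤-refl
  load-⊆ e {fs} {(p , e′) ∷ gs} (0≤p ∷ nn) (_ ∷ʳ fs⊆gs) with load-∷ e p e′
  ... | inj₁ (_ , eq) = subst (load e fs ≤_) (sym (eq gs)) (≤-trans (load-⊆ e nn fs⊆gs) (p≤q+p 0≤p))
  ... | inj₂ (_ , eq) = subst (load e fs ≤_) (sym (eq gs)) (load-⊆ e nn fs⊆gs)
  load-⊆ e {_ ∷ fs} {(p , e′) ∷ gs} (0≤p ∷ nn) (refl ∷ fs⊆gs) with load-∷ e p e′
  ... | inj₁ (_ , eq) = subst₂ _≤_ (sym (eq fs)) (sym (eq gs)) (+-monoʳ-≤ p (load-⊆ e nn fs⊆gs))
  ... | inj₂ (_ , eq) = subst₂ _≤_ (sym (eq fs)) (sym (eq gs)) (load-⊆ e nn fs⊆gs)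

  -- Quantified over all elements, which allows comparing instances with different `B`. As a record
  -- it keeps `fs` visible to unification, where a bare function type would hide it under `load`.
  record WithinCapacity (fs : List Fragment) : Set where
    constructor within
    field load≤1 : ∀ e → load e fs ≤ 1ℚ

  open WithinCapacity

  restrict : ∀ {fs gs} → NonNeg gs → fs ⊆ gs → WithinCapacity gs → WithinCapacity fs
  restrict nn fs⊆gs cap = within λ e → ≤-trans (load-⊆ e nn fs⊆gs) (load≤1 cap e)

  -- Every forced move below comes from this: the forbidden alternative would contain such a pair as
  -- a sublist, and `restrict` passes capacity on to sublists.
  overfull : ∀ {e p} → 0ℚ < p → ¬ WithinCapacity ((1ℚ , e) ∷ (p , e) ∷ [])
  overfull {e} {p} 0<p cap = 1+p≰1 0<p (subst (_≤ 1ℚ) (begin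
    load e ((1ℚ , e) ∷ (p , e) ∷ [])   ≡⟨ load-hit {1ℚ} {e} ((p , e) ∷ []) refl ⟩
    1ℚ + load e ((p , e) ∷ [])         ≡⟨ cong (1ℚ +_) (load-hit {p} {e} [] refl) ⟩
    1ℚ + (p + 0ℚ)                      ≡⟨ cong (1ℚ +_) (+-identityʳ p) ⟩
    1ℚ + p                             ∎) (load≤1 cap e))
    where open ≡-Reasoning

  0<1 : 0ℚ < 1ℚ
  0<1 = *<* (+<+ (ℕ.s≤s ℕ.z≤n))

  -- Selections and valid tradeoffs

  Selection : List (List Tradeoff) → Set
  Selection = All λ ts → Σ[ t ∈ Tradeoff ] t ∈ ts

  chosen : ∀ {tss} → Selection tss → List Fragment
  chosen []            = []
  chosen ((t , _) ∷ s) = t ++ chosen s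

  chosen-++⁺ : ∀ {xs ys} (s : Selection xs) (s′ : Selection ys) → chosen (All.++⁺ s s′) ≡
    chosen s ++ chosen s′
  chosen-++⁺ []            s′ = refl
  chosen-++⁺ ((t , _) ∷ s) s′ = trans (cong (t ++_) (chosen-++⁺ s s′)) (sym (List.++-assoc t _ _))

  chosen-++⁻ : ∀ xs {ys} (s : Selection (xs ++ ys)) → chosen s ≡
    chosen (All.++⁻ˡ xs s) ++ chosen (All.++⁻ʳ xs s)
  chosen-++⁻ []       s             = refl
  chosen-++⁻ (x ∷ xs) ((t , _) ∷ s) =
    trans (cong (t ++_) (chosen-++⁻ xs s)) (sym (List.++-assoc t _ _))

  chosen-All : ∀ {P : Fragment → Set} {tss} → All (All (All P)) tss → (s : Selection tss) →
    All P (chosen s)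
  chosen-All []            []             = []
  chosen-All (pts ∷ ptss) ((t , t∈) ∷ s) = All.++⁺ (All.lookup pts t∈) (chosen-All ptss s)

  All-concatSuffixes : ∀ {A B : Set} {P : A → Set} {Q : B → Set} {f : A → List A → List B} →
    (∀ x xs → P x → All Q (f x xs)) → ∀ {xs} → All P xs → All Q (concatSuffixes f xs)
  All-concatSuffixes h []         = []
  All-concatSuffixes h (px ∷ pxs) = All.++⁺ (h _ _ px) (All-concatSuffixes h pxs)

  Valid : Tradeoff → Set
  Valid t = All Bounded t × sumℚ (map proj₁ t) ≡ 1ℚ

  single-valid : ∀ e → Valid (single e)
  single-valid e = ((0≤1 , ≤-refl) ∷ []) , refl

  spread-valid : ∀ {p} y z → 0ℚ ≤ p → p ≤ 1ℚ → Valid (spread p y z)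
  spread-valid {p} y z 0≤p p≤1 with 1ℚ - p ≟ 0ℚ
  ... | yes 1-p≡0 = ((0≤p , p≤1) ∷ []) , trans (cong (p +_) (sym 1-p≡0)) (p+[1-p]≡1 p)
  ... | no  _     = ((0≤p , p≤1) ∷ (0≤1-p p≤1 , 1-p≤1 0≤p) ∷ []) ,
                    trans (cong (p +_) (+-identityʳ _)) (p+[1-p]≡1 p)

  fragmentSets-valid : ∀ g i f fs → Bounded f → All (All Valid) (fragmentSets g i f fs)
  fragmentSets-valid g i (p , b) fs (0≤p , p≤1) with p ≟ 0ℚ
  ... | yes _ = []
  ... | no  _ = (spread-valid _ _ 0≤p p≤1 ∷ single-valid _ ∷ []) ∷
    (single-valid _ ∷ spread-valid _ _ 0≤p p≤1 ∷ []) ∷ []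

  fragments-valid : ∀ g i {t} → All Bounded t →
    All (All Valid) (concatSuffixes (fragmentSets g i) t)
  fragments-valid g i = All-concatSuffixes (fragmentSets-valid g i)

  tradeoffs-valid : ∀ g {ts} → All Valid ts → All (All Valid) (concatSuffixes (tradeoffSets g) ts)
  tradeoffs-valid g = All-concatSuffixes λ t ts (bounded , _) →
    (single-valid _ ∷ single-valid _ ∷ single-valid _ ∷ []) ∷ fragments-valid g (suc (length ts))
      bounded

  reduced-valid : ∀ {tss} → All (All Valid) tss → All (All Valid) (reducedSets tss)
  reduced-valid = All-concatSuffixes λ ts tss valid →
    (single-valid _ ∷ []) ∷ (single-valid _ ∷ []) ∷ tradeoffs-valid (suc (length tss)) valid

  chosen-nonNeg : ∀ {tss} → All (All Valid) tss → (s : Selection tss) → NonNeg (chosen s)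
  chosen-nonNeg valid = chosen-All (All.map (All.map (All.map proj₁ ∘ proj₁)) valid)

  -- From the reduced instance back to the original one

  original-injective : ∀ {b c} → original b ≡ original c → b ≡ c
  original-injective refl = refl

  -- When the selector is full, the first set of each fragment is pushed to
  -- the slot, hence the second one to the original element.
  fragments-forced : ∀ g i {t} → All Bounded t →
    (s : Selection (concatSuffixes (fragmentSets g i) t)) →
    WithinCapacity ((1ℚ , selector g i) ∷ chosen s) → ∀ b → load b t ≤ load (original b) (chosen s)
  fragments-forced g i [] [] cap b = ≤-refl
  fragments-forced g i {(p , c) ∷ t} ((0≤p , p≤1) ∷ bounded) s cap b with p ≟ 0ℚ
  -- A zero coefficient yields no sets, and it adds nothing to the load either.
  ... | yes refl = ≤-trans (≤-reflexive load-0) (fragments-forced g i bounded s cap b)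
    where
    load-0 : load b ((0ℚ , c) ∷ t) ≡ load b t
    load-0 with load-∷ b 0ℚ c
    ... | inj₁ (_ , eq) = trans (eq t) (+-identityˡ _)
    ... | inj₂ (_ , eq) = eq t
  ... | no p≢0 with s
  ...   | (a , a∈) ∷ (a′ , a′∈) ∷ s′ = go a∈ a′∈ (λ fs⊆ → restrict nn fs⊆ cap)
    where
    j = length t
    nn : NonNeg ((1ℚ , selector g i) ∷ a ++ a′ ++ chosen s′)
    nn = 0≤1 ∷ chosen-nonNeg ((spread-valid _ _ 0≤p p≤1 ∷ single-valid _ ∷ []) ∷
      (single-valid _ ∷ spread-valid _ _ 0≤p p≤1 ∷ []) ∷ fragments-valid g i bounded)
        ((a , a∈) ∷ (a′ , a′∈) ∷ s′)
    nn′ : NonNeg (a ++ a′ ++ chosen s′)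
    nn′ = All.tail nn
    go : a ∈ spread p (selector g i) (sink g i j 0) ∷ single (slot g i j) ∷ [] →
         a′ ∈ single (slot g i j) ∷ spread p (original c) (sink g i j 1) ∷ [] →
         (∀ {fs} → fs ⊆ (1ℚ , selector g i) ∷ a ++ a′ ++ chosen s′ → WithinCapacity fs) →
         load b ((p , c) ∷ t) ≤ load (original b) (a ++ a′ ++ chosen s′)
    go (here refl) _ cap = ⊥-elim (overfull (p≢0⇒0<p 0≤p p≢0) (cap (refl ∷ refl ∷ minimum _)))
    go (there (here refl)) (here refl) cap =
      ⊥-elim (overfull 0<1 (cap (_ ∷ʳ refl ∷ refl ∷ minimum _)))
    go (there (here refl)) (there (here refl)) cap =
      ≤-trans forced (load-⊆ (original b) nn′ (_ ∷ʳ refl ∷ ⊆.++⁺ˡ _ ⊆-refl))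
      where
      ih : load b t ≤ load (original b) (chosen s′)
      ih = fragments-forced g i bounded s′ (cap (refl ∷ _ ∷ʳ _ ∷ʳ ⊆.++⁺ˡ _ ⊆-refl)) b
      forced : load b ((p , c) ∷ t) ≤ load (original b) ((p , original c) ∷ chosen s′)
      forced with load-∷ b p c
      ... | inj₁ (refl , eq) = subst₂ _≤_ (sym (eq t))
        (sym (load-hit {p} {original b} (chosen s′) refl)) (+-monoʳ-≤ p ih)
      ... | inj₂ (c≢b , eq)  = subst₂ _≤_ (sym (eq t))
        (sym (load-miss {p} (chosen s′) (c≢b ∘ original-injective))) ih

  -- A full link pushes each set on to its selector or to the next link;
  -- link 0 is full as well, so some selector is full.
  tradeoff-forced : ∀ g {ts} → All Valid ts → (s : Selection (concatSuffixes (tradeoffSets g) ts)) →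
    WithinCapacity ((1ℚ , link g 0) ∷ (1ℚ , link g (length ts)) ∷ chosen s) →
    ∃[ t ] t ∈ ts × ∀ b → load b t ≤ load (original b) (chosen s)
  -- With no tradeoff left, both full links are `link g 0`.
  tradeoff-forced g [] [] cap = ⊥-elim (overfull 0<1 cap)
  tradeoff-forced g {t ∷ ts} valid@((bounded , _) ∷ valids) s@((u , u∈) ∷ s′) cap =
    go u∈ (λ fs⊆ → restrict nn fs⊆ (subst
      (λ fs → WithinCapacity ((1ℚ , link g 0) ∷ (1ℚ , link g (suc i)) ∷ u ++ fs)) split cap))
    where
    i = length ts
    fragments = concatSuffixes (fragmentSets g (suc i)) t
    s₁ = All.++⁻ˡ fragments s′
    s₂ = All.++⁻ʳ fragments s′
    split : chosen s′ ≡ chosen s₁ ++ chosen s₂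
    split = chosen-++⁻ fragments s′
    nn′ : NonNeg (u ++ chosen s₁ ++ chosen s₂)
    nn′ = subst (λ fs → NonNeg (u ++ fs)) split (chosen-nonNeg (tradeoffs-valid g valid) s)
    nn : NonNeg ((1ℚ , link g 0) ∷ (1ℚ , link g (suc i)) ∷ u ++ chosen s₁ ++ chosen s₂)
    nn = 0≤1 ∷ 0≤1 ∷ nn′
    enlarge : ∀ fs → fs ⊆ u ++ chosen s₁ ++ chosen s₂ → ∀ b → load (original b) fs ≤
      load (original b) (u ++ chosen s′)
    enlarge fs fs⊆ b = subst (λ gs → _ ≤ load (original b) (u ++ gs)) (sym split)
      (load-⊆ (original b) nn′ fs⊆)
    go : u ∈ single (link g (suc i)) ∷ single (selector g (suc i)) ∷ single (link g i) ∷ [] →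
         (∀ {fs} → fs ⊆ (1ℚ , link g 0) ∷ (1ℚ , link g (suc i)) ∷ u ++ chosen s₁ ++ chosen s₂ →
           WithinCapacity fs) →
         ∃[ t′ ] t′ ∈ t ∷ ts × ∀ b → load b t′ ≤ load (original b) (u ++ chosen s′)
    go (here refl) cap = ⊥-elim (overfull 0<1 (cap (_ ∷ʳ refl ∷ refl ∷ minimum _)))
    go (there (here refl)) cap = t , here refl , λ b →
      ≤-trans (fragments-forced g (suc i) bounded s₁ (cap (_ ∷ʳ _ ∷ʳ refl ∷ ⊆.++⁺ʳ _ ⊆-refl)) b)
        (enlarge (chosen s₁) (_ ∷ʳ ⊆.++⁺ʳ _ ⊆-refl) b)
    -- The set occupies `link g i`, which becomes the full upper link for `ts`.
    go (there (there (here refl))) cap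
      with t′ , t′∈ , t′≤ ← tradeoff-forced g valids s₂
        (cap (refl ∷ _ ∷ʳ refl ∷ ⊆.++⁺ˡ (chosen s₁) ⊆-refl)) =
      t′ , there t′∈ , λ b → ≤-trans (t′≤ b)
        (enlarge (chosen s₂) (_ ∷ʳ ⊆.++⁺ˡ (chosen s₁) ⊆-refl) b)

  -- An inequality suffices because capacity bounds loads only from above. If several selectors of a
  -- group are full, the first one met decides.
  selection-forced : ∀ {tss} → All (All Valid) tss → (s : Selection (reducedSets tss)) →
    WithinCapacity (chosen s) →
    Σ[ s₀ ∈ Selection tss ] ∀ b → load b (chosen s₀) ≤ load (original b) (chosen s)
  selection-forced [] [] cap = [] , λ b → ≤-refl
  selection-forced {ts ∷ tss} (valid ∷ valids) s@((v , v∈) ∷ (w , w∈) ∷ s′) cap = go v∈ w∈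
    where
    sets = concatSuffixes (tradeoffSets (suc (length tss))) ts
    s₁ = All.++⁻ˡ sets s′
    s₂ = All.++⁻ʳ sets s′
    split : chosen s′ ≡ chosen s₁ ++ chosen s₂
    split = chosen-++⁻ sets s′
    nn : NonNeg (v ++ w ++ chosen s₁ ++ chosen s₂)
    nn = subst (λ fs → NonNeg (v ++ w ++ fs)) split
      (chosen-nonNeg (reduced-valid (valid ∷ valids)) s)
    cap′ : ∀ {fs} → fs ⊆ v ++ w ++ chosen s₁ ++ chosen s₂ → WithinCapacity fs
    cap′ fs⊆ = restrict nn fs⊆ (subst (λ fs → WithinCapacity (v ++ w ++ fs)) split cap)
    go : v ∈ single (link (suc (length tss)) 0) ∷ [] →
      w ∈ single (link (suc (length tss)) (length ts)) ∷ [] →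
      Σ[ s₀ ∈ Selection (ts ∷ tss) ] ∀ b → load b (chosen s₀) ≤
        load (original b) (v ++ w ++ chosen s′)
    go (here refl) (here refl)
      with t , t∈ , t≤ ← tradeoff-forced (suc (length tss)) valid s₁
        (cap′ (refl ∷ refl ∷ ⊆.++⁺ʳ _ ⊆-refl))
         | s₀ , s₀≤ ← selection-forced valids s₂ (cap′ (_ ∷ʳ _ ∷ʳ ⊆.++⁺ˡ (chosen s₁) ⊆-refl)) =
      (t , t∈) ∷ s₀ , λ b → begin
        load b (t ++ chosen s₀)
          ≡⟨ load-++ b t (chosen s₀) ⟩
        load b t + load b (chosen s₀)
          ≤⟨ +-mono-≤ (t≤ b) (s₀≤ b) ⟩
        load (original b) (chosen s₁) + load (original b) (chosen s₂)
          ≡⟨ sym (load-++ (original b) (chosen s₁) (chosen s₂)) ⟩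
        load (original b) (chosen s₁ ++ chosen s₂)
          ≤⟨ load-⊆ (original b) nn (_ ∷ʳ _ ∷ʳ ⊆-refl) ⟩
        load (original b) (v ++ w ++ chosen s₁ ++ chosen s₂)
          ≡⟨ cong (λ fs → load (original b) (v ++ w ++ fs)) (sym split) ⟩
        load (original b) (v ++ w ++ chosen s′)                               ∎
      where
      open ≤-Reasoning

  -- From the original instance to the reduced one: where names occur

  0+ : ∀ {a b x} → a ≡ 0ℚ → b ≡ x → a + b ≡ x
  0+ {b = b} refl refl = +-identityˡ b

  +0 : ∀ {a b x} → a ≡ x → b ≡ 0ℚ → a + b ≡ x
  +0 {a} refl refl = +-identityʳ a

  0+≤ : ∀ {a b x} → a ≡ 0ℚ → b ≤ x → a + b ≤ x
  0+≤ a≡0 b≤x = ≤-trans (≤-reflexive (0+ a≡0 refl)) b≤x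

  +0≤ : ∀ {a b x} → a ≤ x → b ≡ 0ℚ → a + b ≤ x
  +0≤ a≤x b≡0 = ≤-trans (≤-reflexive (+0 refl b≡0)) a≤x

  ≡0⇒≤1 : ∀ {a} → a ≡ 0ℚ → a ≤ 1ℚ
  ≡0⇒≤1 a≡0 = ≤-trans (≤-reflexive a≡0) 0≤1

  unary-injective : ∀ m n {e e′} → unary m e ≡ unary n e′ → m ≡ n × e ≡ e′
  unary-injective zero    zero    eq = refl , List.∷-injectiveʳ eq
  unary-injective (suc m) (suc n) eq
    with m≡n , e≡e′ ← unary-injective m n (List.∷-injectiveʳ eq) = cong suc m≡n , e≡e′

  opaque
    unfolding fresh

    fresh-injective : ∀ {g i j k g′ i′ j′ k′} → fresh g i j k ≡ fresh g′ i′ j′ k′ → g ≡ g′ × i ≡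
      i′ × j ≡ j′ × k ≡ k′
    fresh-injective {g} {i} {j} {k} {g′} {i′} {j′} {k′} eq
      with g≡ , eq ← unary-injective g g′ (List.∷-injectiveʳ eq)
      with i≡ , eq ← unary-injective i i′ eq
      with j≡ , eq ← unary-injective j j′ eq
      with k≡ , _  ← unary-injective k k′ eq = g≡ , i≡ , j≡ , k≡

    original≢fresh : ∀ {b g i j k} → original b ≢ fresh g i j k
    original≢fresh ()

  Indices : Set₁
  Indices = ℕ → ℕ → ℕ → ℕ → Set

  -- Supports are recorded as conditions on the four indices. Showing that an element does not occur
  -- in a part of the instance then amounts to refuting such a condition.
  data Named (P : Indices) : Element → Set where
    isOriginal : ∀ b → Named P (original b)
    isFresh    : ∀ {g i j k} → P g i j k → Named P (fresh g i j k)

  Supported : Indices → List Fragment → Set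
  Supported P = All (Named P ∘ proj₂)

  weaken : ∀ {P Q : Indices} → (∀ {g i j k} → P g i j k → Q g i j k) → ∀ {e} → Named P e → Named Q e
  weaken P⇒Q (isOriginal b) = isOriginal b
  weaken P⇒Q (isFresh p)    = isFresh (P⇒Q p)

  load-unsupported : ∀ {P g i j k fs} → Supported P fs → ¬ P g i j k → load (fresh g i j k) fs ≡ 0ℚ
  load-unsupported {P} {g} {i} {j} {k} supported ¬p =
    load-unused (All.map (λ {f} → outside f) supported)
    where
    outside : ∀ f → Named P (proj₂ f) → proj₂ f ≢ fresh g i j k
    outside (_ , .(original b)) (isOriginal b) eq = ⊥-elim (original≢fresh eq)
    outside (_ , .(fresh _ _ _ _)) (isFresh p) eq
      with refl , refl , refl , refl ← fresh-injective eq = ¬p p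

  load-concatSuffixes : ∀ {A : Set} (h : A → List A → List Fragment) e m →
    (∀ x xs → length xs ≢ m → load e (h x xs) ≡ 0ℚ) →
    ∀ l → length l ℕ.≤ m → load e (concatSuffixes h l) ≡ 0ℚ
  load-concatSuffixes h e m zero-load []       l≤m = refl
  load-concatSuffixes h e m zero-load (x ∷ xs) l≤m = trans (load-++ e (h x xs) _)
    (0+ (zero-load x xs (ℕ.<⇒≢ l≤m)) (load-concatSuffixes h e m zero-load xs (ℕ.<⇒≤ l≤m)))

  -- Suffix lengths strictly decrease, so at most one block has a suffix of length `m`. An element
  -- owned by index `m` therefore receives its whole load from one block.
  load-private : ∀ {A : Set} {P : A → Set} (h : A → List A → List Fragment) e m →
    (∀ x xs → length xs ≢ m → load e (h x xs) ≡ 0ℚ) →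
    (∀ x xs → P x → load e (h x xs) ≤ 1ℚ) →
    ∀ {l} → All P l → load e (concatSuffixes h l) ≤ 1ℚ
  load-private h e m zero-load ≤1 [] = 0≤1
  load-private h e m zero-load ≤1 {x ∷ xs} (px ∷ pxs) =
    ≤-trans (≤-reflexive (load-++ e (h x xs) _)) (go (length xs ℕ.≟ m))
    where
    go : _ → load e (h x xs) + load e (concatSuffixes h xs) ≤ 1ℚ
    go (yes xs≡m) = +0≤ (≤1 x xs px) (load-concatSuffixes h e m zero-load xs (ℕ.≤-reflexive xs≡m))
    go (no  xs≢m) = 0+≤ (zero-load x xs xs≢m) (load-private h e m zero-load ≤1 pxs)

  load-single-miss : ∀ {e e′} → e′ ≢ e → load e (single e′) ≡ 0ℚ
  load-single-miss e′≢e = load-miss [] e′≢e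

  load-single≤1 : ∀ e e′ → load e (single e′) ≤ 1ℚ
  load-single≤1 e e′ with load-∷ e 1ℚ e′
  ... | inj₁ (_ , eq) = ≤-reflexive (eq [])
  ... | inj₂ (_ , eq) = ≡0⇒≤1 (eq [])

  module _ {p : ℚ} {y z : Element} (y≢z : y ≢ z) where

    load-spread-fst : load y (spread p y z) ≡ p
    load-spread-fst with 1ℚ - p ≟ 0ℚ
    ... | yes _ = trans (load-hit {p} {y} [] refl) (+-identityʳ p)
    ... | no  _ = trans (load-hit {p} {y} _ refl) (+0 refl (load-miss {1ℚ - p} [] (y≢z ∘ sym)))

    load-spread-snd : 0ℚ ≤ p → load z (spread p y z) ≤ 1ℚ
    load-spread-snd 0≤p with 1ℚ - p ≟ 0ℚ
    ... | yes _ = ≡0⇒≤1 (load-miss {p} [] y≢z)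
    ... | no  _ = ≤-trans (≤-reflexive
      (trans (load-miss {p} _ y≢z) (load-hit {1ℚ - p} {z} [] refl)))
                    (+0≤ (1-p≤1 0≤p) refl)

  load-spread-miss : ∀ {p y z e} → y ≢ e → z ≢ e → load e (spread p y z) ≡ 0ℚ
  load-spread-miss {p} {y} {z} y≢e z≢e with 1ℚ - p ≟ 0ℚ
  ... | yes _ = load-miss {p} [] y≢e
  ... | no  _ = trans (load-miss {p} _ y≢e) (load-miss {1ℚ - p} [] z≢e)

  -- A case split on y ≟ᴱ e itself would also rewrite the loads.
  ≡-or-≢ : ∀ (x y : Element) → x ≡ y ⊎ x ≢ y
  ≡-or-≢ x y with x ≟ᴱ y
  ... | yes x≡y = inj₁ x≡y
  ... | no  x≢y = inj₂ x≢y

  load-spread≤1 : ∀ {p y z} → y ≢ z → ∀ e → 0ℚ ≤ p → p ≤ 1ℚ → load e (spread p y z) ≤ 1ℚ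
  load-spread≤1 {p} {y} {z} y≢z e 0≤p p≤1 with ≡-or-≢ y e | ≡-or-≢ z e
  ... | inj₁ refl | _         = ≤-trans (≤-reflexive (load-spread-fst y≢z)) p≤1
  ... | inj₂ _    | inj₁ refl = load-spread-snd y≢z 0≤p
  ... | inj₂ y≢e  | inj₂ z≢e  = ≡0⇒≤1 (load-spread-miss {p} y≢e z≢e)

  load-gadget≤1 : ∀ {p x y z} → x ≢ y → x ≢ z → y ≢ z → ∀ e → 0ℚ ≤ p → p ≤ 1ℚ →
    load e (single x) + load e (spread p y z) ≤ 1ℚ
  load-gadget≤1 {p} {x} {y} {z} x≢y x≢z y≢z e 0≤p p≤1 with ≡-or-≢ x e
  ... | inj₁ refl = +0≤ (load-single≤1 x x) (load-spread-miss {p} (x≢y ∘ sym) (x≢z ∘ sym))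
  ... | inj₂ x≢e  = 0+≤ (load-single-miss x≢e) (load-spread≤1 y≢z e 0≤p p≤1)

  load-++³ : ∀ e fs gs → load e (fs ++ gs ++ []) ≡ load e fs + load e gs
  load-++³ e fs gs = trans (load-++ e fs (gs ++ []))
    (cong (load e fs +_) (trans (load-++ e gs []) (+-identityʳ _)))

  -- Choices for the fragments of one tradeoff

  fragmentChoice : Bool → ∀ g i f fs → Selection (fragmentSets g i f fs)
  fragmentChoice sel g i (p , b) fs with p ≟ 0ℚ
  fragmentChoice sel   g i (p , b) fs | yes _ = []
  fragmentChoice false g i (p , b) fs | no  _ = (_ , here refl) ∷ (_ , here refl) ∷ []
  fragmentChoice true  g i (p , b) fs | no  _ =
    (_ , there (here refl)) ∷ (_ , there (here refl)) ∷ []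

  -- The first alternative covers the slot and the sinks owned by the fragment, the second one the
  -- selector that all fragments of the tradeoff share.
  FragmentIndex : ℕ → ℕ → ℕ → Indices
  FragmentIndex g i n g′ i′ j′ k′ = g′ ≡ g × i′ ≡ i × (j′ ≡ suc n ⊎ j′ ≡ 0 × k′ ≡ 1)

  spread-supported : ∀ {P p y z} → Named P y → Named P z → Supported P (spread p y z)
  spread-supported {p = p} y z with 1ℚ - p ≟ 0ℚ
  ... | yes _ = y ∷ []
  ... | no  _ = y ∷ z ∷ []

  fragmentSets-supported : ∀ g i f fs → All (All (Supported (FragmentIndex g i (length fs))))
    (fragmentSets g i f fs)
  fragmentSets-supported g i (p , b) fs with p ≟ 0ℚ
  ... | yes _ = []
  ... | no  _ =
    (spread-supported (isFresh (refl , refl , inj₂ (refl , refl)))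
      (isFresh (refl , refl , inj₁ refl)) ∷
     (isFresh (refl , refl , inj₁ refl) ∷ []) ∷ []) ∷
    ((isFresh (refl , refl , inj₁ refl) ∷ []) ∷
     spread-supported (isOriginal b) (isFresh (refl , refl , inj₁ refl)) ∷ []) ∷ []

  slot≢selector : ∀ {g i j} → slot g i j ≢ selector g i
  slot≢selector eq with _ , _ , () , _ ← fresh-injective eq

  selector≢sink : ∀ {g i g′ i′ j k} → selector g i ≢ sink g′ i′ j k
  selector≢sink eq with _ , _ , () , _ ← fresh-injective eq

  slot≢sink : ∀ {g i j k} → slot g i j ≢ sink g i j k
  slot≢sink eq with _ , _ , _ , () ← fresh-injective eq

  fragmentChoice≤1 : ∀ sel g i f fs → Bounded f → ∀ e →
    load e (chosen (fragmentChoice sel g i f fs)) ≤ 1ℚ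
  fragmentChoice≤1 sel g i (p , b) fs (0≤p , p≤1) e with p ≟ 0ℚ
  fragmentChoice≤1 sel   g i (p , b) fs (0≤p , p≤1) e | yes _ = 0≤1
  fragmentChoice≤1 false g i (p , b) fs (0≤p , p≤1) e | no  _ = ≤-trans
    (≤-reflexive (trans (load-++³ e (spread p (selector g i) (sink g i (length fs) 0))
      (single (slot g i (length fs))))
        (+-comm (load e (spread p (selector g i) (sink g i (length fs) 0))) _)))
    (load-gadget≤1 {p} (slot≢selector {g} {i}) (slot≢sink {g} {i}) (selector≢sink {g} {i}) e 0≤p
      p≤1)
  fragmentChoice≤1 true g i (p , b) fs (0≤p , p≤1) e | no  _ = ≤-trans
    (≤-reflexive (load-++³ e (single (slot g i (length fs)))
      (spread p (original b) (sink g i (length fs) 1))))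
    (load-gadget≤1 {p} (original≢fresh ∘ sym) (slot≢sink {g} {i}) original≢fresh e 0≤p p≤1)

  fragmentChoice-selector : ∀ g i p b fs →
    load (selector g i) (chosen (fragmentChoice false g i (p , b) fs)) ≡ p
  fragmentChoice-selector g i p b fs with p ≟ 0ℚ
  ... | yes p≡0 = sym p≡0
  ... | no  _   = trans (load-++³ (selector g i)
    (spread p (selector g i) (sink g i (length fs) 0)) (single (slot g i (length fs))))
    (+0 (load-spread-fst {p} (selector≢sink {g} {i})) (load-single-miss (slot≢selector {g} {i})))

  fragmentChoice-selected : ∀ g i f fs →
    load (selector g i) (chosen (fragmentChoice true g i f fs)) ≡ 0ℚ
  fragmentChoice-selected g i (p , b) fs with p ≟ 0ℚ
  ... | yes _ = refl
  ... | no  _ = trans (load-++³ (selector g i) (single (slot g i (length fs)))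
    (spread p (original b) (sink g i (length fs) 1)))
    (0+ (load-single-miss (slot≢selector {g} {i}))
      (load-spread-miss {p} original≢fresh (selector≢sink {g} {i} ∘ sym)))

  fragmentChoice-original : ∀ sel g i f fs b →
    load (original b) (chosen (fragmentChoice sel g i f fs)) ≡
      (ifᵇ sel then load b (f ∷ []) else 0ℚ)
  fragmentChoice-original sel g i (p , c) fs b with p ≟ 0ℚ
  fragmentChoice-original false g i (p , c) fs b | yes _ = refl
  fragmentChoice-original true  g i (p , c) fs b | yes p≡0 with load-∷ b p c
  ... | inj₁ (_ , eq) = sym (trans (eq []) (0+ p≡0 refl))
  ... | inj₂ (_ , eq) = sym (eq [])
  fragmentChoice-original false g i (p , c) fs b | no _ =
    trans (load-++³ (original b) (spread p (selector g i) (sink g i (length fs) 0))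
      (single (slot g i (length fs))))
        (0+ (load-spread-miss {p} (original≢fresh ∘ sym) (original≢fresh ∘ sym))
          (load-single-miss {original b} (original≢fresh ∘ sym)))
  fragmentChoice-original true g i (p , c) fs b | no _ with load-∷ b p c
  ... | inj₁ (refl , eq) = trans (load-++³ (original b) (single (slot g i (length fs)))
    (spread p (original c) (sink g i (length fs) 1)))
    (0+ (load-single-miss {original b} (original≢fresh ∘ sym))
      (trans (load-spread-fst {p} (original≢fresh {b})) (sym (trans (eq []) (+-identityʳ p)))))
  ... | inj₂ (c≢b , eq) = trans (load-++³ (original b) (single (slot g i (length fs)))
    (spread p (original c) (sink g i (length fs) 1)))
    (0+ (load-single-miss {original b} (original≢fresh ∘ sym))
      (trans (load-spread-miss {p} (c≢b ∘ original-injective) (original≢fresh ∘ sym))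
        (sym (eq []))))

  choices : ∀ {A : Set} {f : A → List A → List (List Tradeoff)} → (∀ x xs → Selection (f x xs)) →
    ∀ l → Selection (concatSuffixes f l)
  choices h []       = []
  choices h (x ∷ xs) = All.++⁺ (h x xs) (choices h xs)

  chosen-choices : ∀ {A : Set} {f : A → List A → List (List Tradeoff)}
    (h : ∀ x xs → Selection (f x xs)) l →
    chosen (choices h l) ≡ concatSuffixes (λ x xs → chosen (h x xs)) l
  chosen-choices h []       = refl
  chosen-choices h (x ∷ xs) = trans (chosen-++⁺ (h x xs) _)
    (cong (chosen (h x xs) ++_) (chosen-choices h xs))

  fragmentsChoice : Bool → ∀ g i t → Selection (concatSuffixes (fragmentSets g i) t)
  fragmentsChoice sel g i = choices (fragmentChoice sel g i)

  load-fragmentsChoice : ∀ sel g i e f fs → load e (chosen (fragmentsChoice sel g i (f ∷ fs))) ≡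
    load e (chosen (fragmentChoice sel g i f fs)) + load e (chosen (fragmentsChoice sel g i fs))
  load-fragmentsChoice sel g i e f fs =
    trans (cong (load e) (chosen-++⁺ (fragmentChoice sel g i f fs) _))
      (load-++ e (chosen (fragmentChoice sel g i f fs)) _)

  fragmentsChoice-original : ∀ sel g i t b →
    load (original b) (chosen (fragmentsChoice sel g i t)) ≡ (ifᵇ sel then load b t else 0ℚ)
  fragmentsChoice-original false g i []      b = refl
  fragmentsChoice-original true  g i []      b = refl
  fragmentsChoice-original false g i (f ∷ t) b = trans (load-fragmentsChoice false g i _ f t)
    (0+ (fragmentChoice-original false g i f t b) (fragmentsChoice-original false g i t b))
  fragmentsChoice-original true  g i (f ∷ t) b = trans (load-fragmentsChoice true g i _ f t)
    (trans (cong₂ _+_ (fragmentChoice-original true g i f t b)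
      (fragmentsChoice-original true g i t b))
      (sym (load-++ b (f ∷ []) t)))

  fragmentsChoice-selected : ∀ g i t → load (selector g i) (chosen (fragmentsChoice true g i t)) ≡
    0ℚ
  fragmentsChoice-selected g i []      = refl
  fragmentsChoice-selected g i (f ∷ t) = trans (load-fragmentsChoice true g i (selector g i) f t)
    (0+ (fragmentChoice-selected g i f t) (fragmentsChoice-selected g i t))

  fragmentsChoice-selector : ∀ g i t → load (selector g i) (chosen (fragmentsChoice false g i t))
    ≡ sumℚ (map proj₁ t)
  fragmentsChoice-selector g i []            = refl
  fragmentsChoice-selector g i ((p , b) ∷ t) =
    trans (load-fragmentsChoice false g i (selector g i) (p , b) t)
    (cong₂ _+_ (fragmentChoice-selector g i p b t) (fragmentsChoice-selector g i t))

  -- The last condition excludes the links, whose third and fourth index are both 0.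
  FragmentsIndex : ℕ → ℕ → Indices
  FragmentsIndex g i g′ i′ j′ k′ = g′ ≡ g × i′ ≡ i × (j′ ≢ 0 ⊎ k′ ≡ 1)

  fragments-supported : ∀ g i t →
    All (All (Supported (FragmentsIndex g i))) (concatSuffixes (fragmentSets g i) t)
  fragments-supported g i t = All-concatSuffixes
    (λ f fs _ → All.map (All.map (All.map (weaken λ (g≡ , i≡ , j≡) → g≡ , i≡ , nonlink j≡)))
      (fragmentSets-supported g i f fs))
    (All.universal (λ _ → tt) t)
    where
    nonlink : ∀ {j n k} → j ≡ suc n ⊎ j ≡ 0 × k ≡ 1 → j ≢ 0 ⊎ k ≡ 1
    nonlink (inj₁ refl)       = inj₁ λ ()
    nonlink (inj₂ (_ , k≡1)) = inj₂ k≡1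

  fragmentsChoice-inner : ∀ sel g i {t} → All Bounded t → ∀ j k →
    load (fresh g i (suc j) k) (chosen (fragmentsChoice sel g i t)) ≤ 1ℚ
  fragmentsChoice-inner sel g i {t} bounded j k =
    subst (λ fs → load (fresh g i (suc j) k) fs ≤
      1ℚ) (sym (chosen-choices (fragmentChoice sel g i) t))
      (load-private _ _ j
        (λ f fs fs≢j → load-unsupported
          (chosen-All (fragmentSets-supported g i f fs) (fragmentChoice sel g i f fs))
          λ { (_ , _ , inj₁ refl) → fs≢j refl ; (_ , _ , inj₂ (() , _)) })
        (λ f fs b → fragmentChoice≤1 sel g i f fs b (fresh g i (suc j) k))
        bounded)

  fragmentsChoice≤1 : ∀ sel g i {t} → Valid t → ∀ g′ i′ j k →
    load (fresh g′ i′ j k) (chosen (fragmentsChoice sel g i t)) ≤ 1ℚ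
  fragmentsChoice≤1 sel g i {t} (bounded , total) g′ i′ j k with g′ ℕ.≟ g | i′ ℕ.≟ i
  ... | no g′≢g  | _        = ≡0⇒≤1
    (load-unsupported (chosen-All (fragments-supported g i t) (fragmentsChoice sel g i t))
      (g′≢g ∘ proj₁))
  ... | yes _    | no i′≢i  = ≡0⇒≤1
    (load-unsupported (chosen-All (fragments-supported g i t) (fragmentsChoice sel g i t))
      (i′≢i ∘ proj₁ ∘ proj₂))
  ... | yes refl | yes refl = go sel j k
    where
    go : ∀ sel j k → load (fresh g i j k) (chosen (fragmentsChoice sel g i t)) ≤ 1ℚ
    go sel   (suc j) k             = fragmentsChoice-inner sel g i bounded j k
    go false zero    1             = ≤-reflexive (trans (fragmentsChoice-selector g i t) total)
    go true  zero    1             = ≡0⇒≤1 (fragmentsChoice-selected g i t)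
    go sel   zero    zero          =
      ≡0⇒≤1 (load-unsupported (chosen-All (fragments-supported g i t) (fragmentsChoice sel g i t))
        λ { (_ , _ , inj₁ 0≢0) → 0≢0 refl ; (_ , _ , inj₂ ()) })
    -- These indices name nothing in the instance.
    go sel   zero    (suc (suc k)) =
      ≡0⇒≤1 (load-unsupported (chosen-All (fragments-supported g i t) (fragmentsChoice sel g i t))
        λ { (_ , _ , inj₁ 0≢0) → 0≢0 refl ; (_ , _ , inj₂ ()) })

  -- Choices along the links of one group

  -- What the set of a tradeoff occupies: its lower link, its selector or its upper link. Tradeoffs
  -- listed before the chosen one push and those after it pull, so no inner link is claimed twice
  -- and both end links stay available.
  data Mode : Set where
    push pick pull : Mode

  taken : Mode → ℕ → ℕ → Element
  taken pull g n = link g (suc n)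
  taken pick g n = selector g (suc n)
  taken push g n = link g n

  isPick : Mode → Bool
  isPick pick = true
  isPick _    = false

  setChoice : Mode → ∀ g t ts → Selection (tradeoffSets g t ts)
  setChoice pull g t ts = (_ , here refl) ∷ fragmentsChoice false g (suc (length ts)) t
  setChoice pick g t ts = (_ , there (here refl)) ∷ fragmentsChoice true g (suc (length ts)) t
  setChoice push g t ts = (_ , there (there (here refl))) ∷ fragmentsChoice false g
    (suc (length ts)) t

  load-setChoice : ∀ m g t ts e → load e (chosen (setChoice m g t ts)) ≡
    load e (single (taken m g (length ts))) + load e
      (chosen (fragmentsChoice (isPick m) g (suc (length ts)) t))
  load-setChoice pull g t ts e = load-++ e (single (taken pull g (length ts)))
    (chosen (fragmentsChoice false g (suc (length ts)) t))
  load-setChoice pick g t ts e = load-++ e (single (taken pick g (length ts)))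
    (chosen (fragmentsChoice true g (suc (length ts)) t))
  load-setChoice push g t ts e = load-++ e (single (taken push g (length ts)))
    (chosen (fragmentsChoice false g (suc (length ts)) t))

  load-setChoice-++⁺ : ∀ m g t ts (s : Selection (concatSuffixes (tradeoffSets g) ts)) e →
    load e (chosen (All.++⁺ (setChoice m g t ts) s)) ≡
    load e (single (taken m g (length ts))) +
      load e (chosen (fragmentsChoice (isPick m) g (suc (length ts)) t)) + load e (chosen s)
  load-setChoice-++⁺ m g t ts s e = begin
    load e (chosen (All.++⁺ (setChoice m g t ts) s))
      ≡⟨ cong (load e) (chosen-++⁺ (setChoice m g t ts) s) ⟩
    load e (chosen (setChoice m g t ts) ++ chosen s)
      ≡⟨ load-++ e (chosen (setChoice m g t ts)) (chosen s) ⟩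
    load e (chosen (setChoice m g t ts)) + load e (chosen s)
      ≡⟨ cong (_+ load e (chosen s)) (load-setChoice m g t ts e) ⟩
    load e (single (taken m g (length ts))) +
      load e (chosen (fragmentsChoice (isPick m) g (suc (length ts)) t)) + load e (chosen s) ∎
    where open ≡-Reasoning

  -- The part of a group behind the chosen tradeoff. Pulling everywhere keeps link 0 clear for its
  -- own set.
  noChoice : ∀ g ts → Selection (concatSuffixes (tradeoffSets g) ts)
  noChoice g []       = []
  noChoice g (t ∷ ts) = All.++⁺ (setChoice pull g t ts) (noChoice g ts)

  tradeoffChoice : ∀ g {t ts} → t ∈ ts → Selection (concatSuffixes (tradeoffSets g) ts)
  tradeoffChoice g {ts = t ∷ ts} (here _)   = All.++⁺ (setChoice pick g t ts) (noChoice g ts)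
  tradeoffChoice g {ts = t ∷ ts} (there t∈) = All.++⁺ (setChoice push g t ts) (tradeoffChoice g t∈)

  load-setChoice-original : ∀ m g t ts (s : Selection (concatSuffixes (tradeoffSets g) ts)) b →
    load (original b) (chosen (All.++⁺ (setChoice m g t ts) s)) ≡
    (ifᵇ isPick m then load b t else 0ℚ) + load (original b) (chosen s)
  load-setChoice-original m g t ts s b = trans (load-setChoice-++⁺ m g t ts s (original b))
    (cong (_+ load (original b) (chosen s)) (0+ (load-single-miss {original b} (taken≢original m))
      (fragmentsChoice-original (isPick m) g (suc (length ts)) t b)))
    where
    taken≢original : ∀ m → taken m g (length ts) ≢ original b
    taken≢original push eq = original≢fresh (sym eq)
    taken≢original pick eq = original≢fresh (sym eq)
    taken≢original pull eq = original≢fresh (sym eq)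

  noChoice-original : ∀ g ts b → load (original b) (chosen (noChoice g ts)) ≡ 0ℚ
  noChoice-original g []       b = refl
  noChoice-original g (t ∷ ts) b = trans (load-setChoice-original pull g t ts (noChoice g ts) b)
    (0+ refl (noChoice-original g ts b))

  tradeoffChoice-original : ∀ g {t ts} (t∈ : t ∈ ts) b →
    load (original b) (chosen (tradeoffChoice g t∈)) ≡ load b t
  tradeoffChoice-original g {ts = t ∷ ts} (here refl) b =
    trans (load-setChoice-original pick g t ts (noChoice g ts) b)
      (+0 refl (noChoice-original g ts b))
  tradeoffChoice-original g {ts = t ∷ ts} (there t∈)  b =
    trans (load-setChoice-original push g t ts (tradeoffChoice g t∈) b)
      (0+ refl (tradeoffChoice-original g t∈ b))

  TradeoffsIndex : ℕ → ℕ → Indices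
  TradeoffsIndex g n g′ i′ _ _ = g′ ≡ g × i′ ℕ.≤ n

  tradeoffs-supported : ∀ g ts → All (All (Supported (TradeoffsIndex g (length ts))))
    (concatSuffixes (tradeoffSets g) ts)
  tradeoffs-supported g []       = []
  tradeoffs-supported g (t ∷ ts) =
    ((isFresh (refl , ℕ.≤-refl) ∷ []) ∷ (isFresh (refl , ℕ.≤-refl) ∷ []) ∷
      (isFresh (refl , ℕ.n≤1+n _) ∷ []) ∷ []) ∷
    All.++⁺
      (All.map (All.map (All.map (weaken λ (g≡ , i≡ , _) → g≡ , ℕ.≤-reflexive i≡)))
        (fragments-supported g (suc (length ts)) t))
      (All.map (All.map (All.map (weaken λ (g≡ , i≤) → g≡ , ℕ.m≤n⇒m≤1+n i≤)))
        (tradeoffs-supported g ts))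

  fragmentsChoice-link : ∀ sel g i t g′ i′ →
    load (link g′ i′) (chosen (fragmentsChoice sel g i t)) ≡ 0ℚ
  fragmentsChoice-link sel g i t g′ i′ =
    load-unsupported (chosen-All (fragments-supported g i t) (fragmentsChoice sel g i t))
    λ { (_ , _ , inj₁ 0≢0) → 0≢0 refl ; (_ , _ , inj₂ ()) }

  -- Links are shared by neighbouring tradeoffs and are counted separately; every other fresh name
  -- of a group belongs to a single tradeoff index.
  NonLink : ℕ → ℕ → Set
  NonLink j k = ¬ (j ≡ 0 × k ≡ 0)

  link≢ : ∀ {g i g′ i′ j k} → NonLink j k → link g i ≢ fresh g′ i′ j k
  link≢ nonlink eq with _ , _ , refl , refl ← fresh-injective eq = nonlink (refl , refl)

  link≢link : ∀ {g i g′ i′} → i ≢ i′ → link g i ≢ link g′ i′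
  link≢link i≢i′ eq with _ , i≡i′ , _ ← fresh-injective eq = i≢i′ i≡i′

  setChoice≤1 : ∀ m g {t} ts → Valid t → ∀ g′ i j k → NonLink j k →
    load (fresh g′ i j k) (chosen (setChoice m g t ts)) ≤ 1ℚ
  setChoice≤1 m g {t} ts valid g′ i j k nonlink =
    ≤-trans (≤-reflexive (load-setChoice m g t ts e)) (go m (≡-or-≢ (taken m g (length ts)) e))
    where
    e = fresh g′ i j k
    go : ∀ m → taken m g (length ts) ≡ e ⊎ taken m g (length ts) ≢ e →
      load e (single (taken m g (length ts))) + load e
        (chosen (fragmentsChoice (isPick m) g (suc (length ts)) t)) ≤ 1ℚ
    go m    (inj₂ ≢e) = 0+≤ (load-single-miss ≢e)
      (fragmentsChoice≤1 (isPick m) g (suc (length ts)) valid g′ i j k)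
    go push (inj₁ eq) = ⊥-elim (link≢ nonlink eq)
    go pull (inj₁ eq) = ⊥-elim (link≢ nonlink eq)
    -- The set fills the selector, and the fragments of a selected tradeoff all stay off it.
    go pick (inj₁ eq) = +0≤ (load-single≤1 e (selector g (suc (length ts))))
      (subst (λ e → load e (chosen (fragmentsChoice true g (suc (length ts)) t)) ≡ 0ℚ) eq
        (fragmentsChoice-selected g (suc (length ts)) t))

  setChoice-zero : ∀ m g t ts g′ i j k → NonLink j k → i ≢ suc (length ts) →
    load (fresh g′ i j k) (chosen (setChoice m g t ts)) ≡ 0ℚ
  setChoice-zero m g t ts g′ i j k nonlink i≢ = trans (load-setChoice m g t ts (fresh g′ i j k))
    (0+ (load-single-miss (taken≢ m))
      (load-unsupported (chosen-All (fragments-supported g (suc (length ts)) t)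
        (fragmentsChoice (isPick m) g (suc (length ts)) t)) (i≢ ∘ proj₁ ∘ proj₂)))
    where
    taken≢ : ∀ m → taken m g (length ts) ≢ fresh g′ i j k
    taken≢ push eq = link≢ nonlink eq
    taken≢ pull eq = link≢ nonlink eq
    taken≢ pick eq = i≢ (sym (proj₁ (proj₂ (fresh-injective eq))))

  setChoice-++⁺≤1 : ∀ m g {t} ts → Valid t →
    (s : Selection (concatSuffixes (tradeoffSets g) ts)) → ∀ g′ i j k → NonLink j k →
    load (fresh g′ i j k) (chosen s) ≤
      1ℚ → load (fresh g′ i j k) (chosen (All.++⁺ (setChoice m g t ts) s)) ≤ 1ℚ
  setChoice-++⁺≤1 m g {t} ts valid s g′ i j k nonlink s≤1 = ≤-trans (≤-reflexive
    (trans (cong (load e) (chosen-++⁺ (setChoice m g t ts) s))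
      (load-++ e (chosen (setChoice m g t ts)) (chosen s)))) (go (i ℕ.≟ suc (length ts)))
    where
    e = fresh g′ i j k
    go : _ → load e (chosen (setChoice m g t ts)) + load e (chosen s) ≤ 1ℚ
    -- The remaining tradeoffs only use indices up to `length ts`.
    go (yes refl) = +0≤ (setChoice≤1 m g ts valid g′ i j k nonlink)
      (load-unsupported (chosen-All (tradeoffs-supported g ts) s) (ℕ.1+n≰n ∘ proj₂))
    go (no i≢)    = 0+≤ (setChoice-zero m g t ts g′ i j k nonlink i≢) s≤1

  noChoice≤1 : ∀ g {ts} → All Valid ts → ∀ g′ i j k → NonLink j k →
    load (fresh g′ i j k) (chosen (noChoice g ts)) ≤ 1ℚ
  noChoice≤1 g []                        g′ i j k nonlink = 0≤1
  noChoice≤1 g {t ∷ ts} (valid ∷ valids) g′ i j k nonlink =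
    setChoice-++⁺≤1 pull g ts valid (noChoice g ts) g′ i j k nonlink
      (noChoice≤1 g valids g′ i j k nonlink)

  tradeoffChoice≤1 : ∀ g {t ts} → All Valid ts → (t∈ : t ∈ ts) → ∀ g′ i j k → NonLink j k →
    load (fresh g′ i j k) (chosen (tradeoffChoice g t∈)) ≤ 1ℚ
  tradeoffChoice≤1 g {ts = t ∷ ts} (valid ∷ valids) (here _)   g′ i j k nonlink =
    setChoice-++⁺≤1 pick g ts valid (noChoice g ts) g′ i j k nonlink
      (noChoice≤1 g valids g′ i j k nonlink)
  tradeoffChoice≤1 g {ts = t ∷ ts} (valid ∷ valids) (there t∈) g′ i j k nonlink =
    setChoice-++⁺≤1 push g ts valid (tradeoffChoice g t∈) g′ i j k nonlink
      (tradeoffChoice≤1 g valids t∈ g′ i j k nonlink)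

  load-setChoice-link : ∀ m g t ts (s : Selection (concatSuffixes (tradeoffSets g) ts)) i →
    load (link g i) (chosen (All.++⁺ (setChoice m g t ts) s)) ≡
    load (link g i) (single (taken m g (length ts))) + load (link g i) (chosen s)
  load-setChoice-link m g t ts s i = trans (load-setChoice-++⁺ m g t ts s (link g i))
    (cong (_+ load (link g i) (chosen s))
      (+0 {load (link g i) (single (taken m g (length ts)))} refl
        (fragmentsChoice-link (isPick m) g (suc (length ts)) t g i)))

  -- noChoice fills the links 1 , … , n and tradeoffChoice the links
  -- 1 , … , n - 1, where n is the number of tradeoffs.
  noChoice-link-zero : ∀ g ts i → i ≡ 0 ⊎
    length ts ℕ.< i → load (link g i) (chosen (noChoice g ts)) ≡ 0ℚ
  noChoice-link-zero g []       i unlinked = refl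
  noChoice-link-zero g (t ∷ ts) i unlinked =
    trans (load-setChoice-link pull g t ts (noChoice g ts) i)
    (0+ (load-single-miss (link≢link (miss unlinked)))
      (noChoice-link-zero g ts i (smaller unlinked)))
    where
    miss : i ≡ 0 ⊎ suc (length ts) ℕ.< i → suc (length ts) ≢ i
    miss (inj₁ refl) ()
    miss (inj₂ n<i)  = ℕ.<⇒≢ n<i
    smaller : i ≡ 0 ⊎ suc (length ts) ℕ.< i → i ≡ 0 ⊎ length ts ℕ.< i
    smaller (inj₁ i≡0) = inj₁ i≡0
    smaller (inj₂ n<i) = inj₂ (ℕ.<⇒≤ n<i)

  noChoice-link≤1 : ∀ g ts i → load (link g i) (chosen (noChoice g ts)) ≤ 1ℚ
  noChoice-link≤1 g []       i = 0≤1
  noChoice-link≤1 g (t ∷ ts) i = ≤-trans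
    (≤-reflexive (load-setChoice-link pull g t ts (noChoice g ts) i)) (go (suc (length ts) ℕ.≟ i))
    where
    go : _ → load (link g i) (single (link g (suc (length ts)))) + load (link g i)
      (chosen (noChoice g ts)) ≤ 1ℚ
    go (yes refl) = +0≤ (load-single≤1 (link g i) (link g (suc (length ts))))
      (noChoice-link-zero g ts i (inj₂ ℕ.≤-refl))
    go (no n≢i)   = 0+≤ (load-single-miss (link≢link n≢i)) (noChoice-link≤1 g ts i)

  selector≢link : ∀ {g i g′ i′} → selector g i ≢ link g′ i′
  selector≢link eq with _ , _ , _ , () ← fresh-injective eq

  ∈⇒length≢0 : ∀ {A : Set} {x : A} {xs} → x ∈ xs → length xs ≢ 0
  ∈⇒length≢0 (here _)  ()
  ∈⇒length≢0 (there _) ()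

  tradeoffChoice-link-zero : ∀ g {t ts} (t∈ : t ∈ ts) i → i ≡ 0 ⊎
    length ts ℕ.≤ i → load (link g i) (chosen (tradeoffChoice g t∈)) ≡ 0ℚ
  tradeoffChoice-link-zero g {ts = t ∷ ts} (here _) i unlinked =
    trans (load-setChoice-link pick g t ts (noChoice g ts) i)
    (0+ (load-single-miss selector≢link) (noChoice-link-zero g ts i unlinked))
  tradeoffChoice-link-zero g {ts = t ∷ ts} (there t∈) i unlinked =
    trans (load-setChoice-link push g t ts (tradeoffChoice g t∈) i)
    (0+ (load-single-miss (link≢link (miss unlinked)))
      (tradeoffChoice-link-zero g t∈ i (smaller unlinked)))
    where
    miss : i ≡ 0 ⊎ suc (length ts) ℕ.≤ i → length ts ≢ i
    miss (inj₁ refl) = ∈⇒length≢0 t∈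
    miss (inj₂ n<i)  = ℕ.<⇒≢ n<i
    smaller : i ≡ 0 ⊎ suc (length ts) ℕ.≤ i → i ≡ 0 ⊎ length ts ℕ.≤ i
    smaller (inj₁ i≡0) = inj₁ i≡0
    smaller (inj₂ n<i) = inj₂ (ℕ.<⇒≤ n<i)

  tradeoffChoice-link≤1 : ∀ g {t ts} (t∈ : t ∈ ts) i →
    load (link g i) (chosen (tradeoffChoice g t∈)) ≤ 1ℚ
  tradeoffChoice-link≤1 g {ts = t ∷ ts} (here _) i =
    ≤-trans (≤-reflexive (load-setChoice-link pick g t ts (noChoice g ts) i))
    (0+≤ (load-single-miss selector≢link) (noChoice-link≤1 g ts i))
  tradeoffChoice-link≤1 g {ts = t ∷ ts} (there t∈) i =
    ≤-trans (≤-reflexive (load-setChoice-link push g t ts (tradeoffChoice g t∈) i))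
      (go (length ts ℕ.≟ i))
    where
    go : _ → load (link g i) (single (link g (length ts))) + load (link g i)
      (chosen (tradeoffChoice g t∈)) ≤ 1ℚ
    go (yes refl) = +0≤ (load-single≤1 (link g i) (link g (length ts)))
      (tradeoffChoice-link-zero g t∈ i (inj₂ ℕ.≤-refl))
    go (no n≢i)   = 0+≤ (load-single-miss (link≢link n≢i)) (tradeoffChoice-link≤1 g t∈ i)

  groupChoice : ∀ {t ts} tss → t ∈ ts → Selection (groupSets ts tss)
  groupChoice tss t∈ = (_ , here refl) ∷ (_ , here refl) ∷ tradeoffChoice (suc (length tss)) t∈

  load-groupChoice : ∀ {t ts} tss (t∈ : t ∈ ts) e → load e (chosen (groupChoice tss t∈)) ≡
    load e (single (link (suc (length tss)) 0)) +
    (load e (single (link (suc (length tss)) (length ts))) + load e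
      (chosen (tradeoffChoice (suc (length tss)) t∈)))
  load-groupChoice {ts = ts} tss t∈ e =
    trans (load-++ e (single (link g 0))
      (single (link g (length ts)) ++ chosen (tradeoffChoice g t∈)))
      (cong (load e (single (link g 0)) +_)
        (load-++ e (single (link g (length ts))) (chosen (tradeoffChoice g t∈))))
    where g = suc (length tss)

  groupChoice≤1 : ∀ {t ts} tss → All Valid ts → (t∈ : t ∈ ts) → ∀ i j k →
    load (fresh (suc (length tss)) i j k) (chosen (groupChoice tss t∈)) ≤ 1ℚ
  groupChoice≤1 {ts = ts} tss valid t∈ i j k =
    ≤-trans (≤-reflexive (load-groupChoice tss t∈ (fresh g i j k))) (go j k)
    where
    g = suc (length tss)
    private≤1 : ∀ {j k} → NonLink j k → load (fresh g i j k) (single (link g 0)) +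
      (load (fresh g i j k) (single (link g (length ts))) + load (fresh g i j k)
        (chosen (tradeoffChoice g t∈))) ≤ 1ℚ
    private≤1 nonlink = 0+≤ (load-single-miss (link≢ {g} {0} nonlink))
      (0+≤ (load-single-miss (link≢ {g} {length ts} nonlink))
        (tradeoffChoice≤1 g valid t∈ g i _ _ nonlink))
    go : ∀ j k → load (fresh g i j k) (single (link g 0)) +
      (load (fresh g i j k) (single (link g (length ts))) + load (fresh g i j k)
        (chosen (tradeoffChoice g t∈))) ≤ 1ℚ
    go (suc j) k       = private≤1 {suc j} {k} λ ()
    go zero    (suc k) = private≤1 {0} {suc k} λ ()
    go zero    zero with i ℕ.≟ 0 | length ts ℕ.≟ i
    -- The two end links differ because a group with a chosen tradeoff is nonempty.
    ... | yes refl | _        = +0≤ (load-single≤1 (link g 0) (link g 0))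
      (0+ (load-single-miss {link g 0} {link g (length ts)} (link≢link (∈⇒length≢0 t∈)))
        (tradeoffChoice-link-zero g t∈ 0 (inj₁ refl)))
    ... | no i≢0   | yes refl = 0+≤ (load-single-miss {link g i} {link g 0} (link≢link (i≢0 ∘ sym)))
      (+0≤ (load-single≤1 (link g i) (link g (length ts)))
        (tradeoffChoice-link-zero g t∈ i (inj₂ ℕ.≤-refl)))
    ... | no i≢0   | no n≢i   = 0+≤ (load-single-miss {link g i} {link g 0} (link≢link (i≢0 ∘ sym)))
      (0+≤ (load-single-miss {link g i} {link g (length ts)} (link≢link n≢i))
        (tradeoffChoice-link≤1 g t∈ i))

  -- All groups together

  groupSets-supported : ∀ ts tss → All (All (Supported (λ g _ _ _ → g ≡ suc (length tss))))
    (groupSets ts tss)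
  groupSets-supported ts tss = ((isFresh refl ∷ []) ∷ []) ∷ ((isFresh refl ∷ []) ∷ []) ∷
    All.map (All.map (All.map (weaken proj₁))) (tradeoffs-supported (suc (length tss)) ts)

  reduced-supported : ∀ tss → All (All (Supported (λ g _ _ _ → g ℕ.≤ length tss))) (reducedSets tss)
  reduced-supported []         = []
  reduced-supported (ts ∷ tss) = All.++⁺
    (All.map (All.map (All.map (weaken ℕ.≤-reflexive))) (groupSets-supported ts tss))
    (All.map (All.map (All.map (weaken ℕ.m≤n⇒m≤1+n))) (reduced-supported tss))

  reducedChoice : ∀ {tss} → Selection tss → Selection (reducedSets tss)
  reducedChoice []                            = []
  reducedChoice {ts ∷ tss} ((t , t∈) ∷ s) = All.++⁺ (groupChoice tss t∈) (reducedChoice s)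

  load-reducedChoice : ∀ {ts tss t} (t∈ : t ∈ ts) (s : Selection tss) e →
    load e (chosen (reducedChoice {ts ∷ tss} ((t , t∈) ∷ s))) ≡
    load e (chosen (groupChoice tss t∈)) + load e (chosen (reducedChoice s))
  load-reducedChoice {tss = tss} t∈ s e =
    trans (cong (load e) (chosen-++⁺ (groupChoice tss t∈) (reducedChoice s)))
    (load-++ e (chosen (groupChoice tss t∈)) (chosen (reducedChoice s)))

  reducedChoice-original : ∀ {tss} (s : Selection tss) b →
    load (original b) (chosen (reducedChoice s)) ≡ load b (chosen s)
  reducedChoice-original [] b = refl
  reducedChoice-original {ts ∷ tss} ((t , t∈) ∷ s) b = begin
    load (original b) (chosen (reducedChoice ((t , t∈) ∷ s)))
      ≡⟨ load-reducedChoice t∈ s (original b) ⟩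
    load (original b) (chosen (groupChoice tss t∈)) + load (original b) (chosen (reducedChoice s))
      ≡⟨ cong₂ _+_
           (trans (load-groupChoice tss t∈ (original b))
             (0+ (load-single-miss {original b} (original≢fresh ∘ sym))
             (0+ (load-single-miss {original b} (original≢fresh ∘ sym))
               (tradeoffChoice-original (suc (length tss)) t∈ b))))
           (reducedChoice-original s b) ⟩
    load b t + load b (chosen s)
      ≡⟨ sym (load-++ b t (chosen s)) ⟩
    load b (t ++ chosen s) ∎
    where open ≡-Reasoning

  reducedChoice-fresh : ∀ {tss} → All (All Valid) tss → (s : Selection tss) → ∀ g i j k →
    load (fresh g i j k) (chosen (reducedChoice s)) ≤ 1ℚ
  reducedChoice-fresh [] [] g i j k = 0≤1
  reducedChoice-fresh {ts ∷ tss} (valid ∷ valids) ((t , t∈) ∷ s) g i j k =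
    ≤-trans (≤-reflexive (load-reducedChoice t∈ s (fresh g i j k))) (go (g ℕ.≟ suc (length tss)))
    where
    go : _ → load (fresh g i j k) (chosen (groupChoice tss t∈)) + load (fresh g i j k)
      (chosen (reducedChoice s)) ≤ 1ℚ
    go (yes refl) = +0≤ (groupChoice≤1 tss valid t∈ i j k)
      (load-unsupported (chosen-All (reduced-supported tss) (reducedChoice s)) ℕ.1+n≰n)
    go (no g≢)    = 0+≤ (load-unsupported
      (chosen-All (groupSets-supported ts tss) (groupChoice tss t∈)) g≢)
      (reducedChoice-fresh valids s g i j k)

  -- Capacity is claimed for arbitrary bit strings, which need not be names or members of `B`. Those
  -- that no fragment mentions have load 0; the others inherit what is known of all fragments.
  unused-or : ∀ {P : Element → Set} e {fs} → All (P ∘ proj₂) fs → load e fs ≡ 0ℚ ⊎ P e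
  unused-or {P} e {fs} ps with Any.any? (λ f → proj₂ f ≟ᴱ e) fs
  ... | yes e∈ = inj₂ (All.lookupWith (λ p eq → subst P eq p) ps e∈)
  ... | no  e∉ = inj₁ (load-unused (All.¬Any⇒All¬ fs e∉))

  reducedChoice-within : ∀ {tss} → All (All Valid) tss → (s : Selection tss) →
    WithinCapacity (chosen s) →
    WithinCapacity (chosen (reducedChoice s))
  reducedChoice-within {tss} valid s cap = within λ e →
    go e (unused-or e (chosen-All (reduced-supported tss) (reducedChoice s)))
    where
    go : ∀ {P} e → load e (chosen (reducedChoice s)) ≡ 0ℚ ⊎
      Named P e → load e (chosen (reducedChoice s)) ≤ 1ℚ
    go e (inj₁ unused) = ≡0⇒≤1 unused
    go .(original b) (inj₂ (isOriginal b)) = ≤-trans (≤-reflexive (reducedChoice-original s b))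
      (load≤1 cap b)
    go .(fresh _ _ _ _) (inj₂ (isFresh {g} {i} {j} {k} _)) = reducedChoice-fresh valid s g i j k

  -- Solutions as selections, and the reduction as a map of instances

  HasSelection : List (List Tradeoff) → Set
  HasSelection tss = Σ[ s ∈ Selection tss ] WithinCapacity (chosen s)

  chosen-tabulate⁺ : ∀ {n} {T : Fin n → List Tradeoff} (c : ∀ g → Σ[ t ∈ Tradeoff ] t ∈ T g) →
    chosen (All.tabulate⁺ {f = T} c) ≡ concat (tabulate (proj₁ ∘ c))
  chosen-tabulate⁺ {zero}  c = refl
  chosen-tabulate⁺ {suc n} c = cong (proj₁ (c zero) ++_) (chosen-tabulate⁺ (c ∘ suc))

  chosen-tabulate⁻ : ∀ {n} {T : Fin n → List Tradeoff} (s : Selection (tabulate T)) →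
    concat (tabulate (proj₁ ∘ All.tabulate⁻ {f = T} s)) ≡ chosen s
  chosen-tabulate⁻ {zero}  []            = refl
  chosen-tabulate⁻ {suc n} ((t , _) ∷ s) = cong (t ++_) (chosen-tabulate⁻ s)

  -- Selections within capacity are solutions, since an element outside B
  -- has load 0.
  module _ (ℱ : FMP) where
    open FMP ℱ

    solution⇒selection : Solution ℱ → HasSelection (tabulate T)
    solution⇒selection sol = s , within λ e → go e (unused-or e used)
      where
      open Solution sol
      s = All.tabulate⁺ {f = T} λ g → choice g , choice∈T g
      used : All ((_∈ B) ∘ proj₂) (chosen s)
      used = chosen-All (All.tabulate⁺ λ g → All.map IsTradeoff.elements (isTradeoff g)) s
      go : ∀ e → load e (chosen s) ≡ 0ℚ ⊎ e ∈ B → load e (chosen s) ≤ 1ℚ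
      go e (inj₁ unused) = ≡0⇒≤1 unused
      go e (inj₂ e∈B)    = subst (λ fs → load e fs ≤
        1ℚ) (sym (chosen-tabulate⁺ λ g → choice g , choice∈T g)) (All.lookup capacity e∈B)

    selection⇒solution : HasSelection (tabulate T) → Solution ℱ
    selection⇒solution (s , cap) = record
      { choice   = proj₁ ∘ All.tabulate⁻ s
      ; choice∈T = proj₂ ∘ All.tabulate⁻ s
      ; capacity = All.universal (λ b → subst (λ fs → load b fs ≤ 1ℚ) (sym (chosen-tabulate⁻ s))
        (load≤1 cap b)) B
      }

  ∈-concatSuffixes : ∀ {A B : Set} (f : A → List B) {x y xs} → x ∈ xs → y ∈ f x →
    y ∈ concatSuffixes (λ x _ → f x) xs
  ∈-concatSuffixes f               (here refl) y∈ = ∈-++⁺ˡ y∈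
  ∈-concatSuffixes f {xs = x ∷ _} (there x∈)  y∈ = ∈-++⁺ʳ (f x) (∈-concatSuffixes f x∈ y∈)

  ∈-elementsOf : ∀ {tss ts t f} → ts ∈ tss → t ∈ ts → f ∈ t → proj₂ f ∈ elementsOf tss
  ∈-elementsOf ts∈ t∈ f∈ =
    ∈-concatSuffixes (concatSuffixes λ t _ → concatSuffixes (λ f _ → proj₂ f ∷ []) t) ts∈
      (∈-concatSuffixes (concatSuffixes λ f _ → proj₂ f ∷ []) t∈
        (∈-concatSuffixes (λ f → proj₂ f ∷ []) f∈ (here refl)))

  groups : FMP → List (List Tradeoff)
  groups ℱ = tabulate (FMP.T ℱ)

  groups-valid : ∀ ℱ → All (All Valid) (groups ℱ)
  groups-valid ℱ = All.tabulate⁺ λ g → All.map (λ t → IsTradeoff.bounds t , IsTradeoff.total t)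
    (FMP.isTradeoff ℱ g)

  reduce : FMP → FMP
  reduce ℱ = record
    { ∣G∣        = length tss
    ; B          = elementsOf tss
    ; T          = lookup tss
    ; isTradeoff = λ g → All.tabulate λ {t} t∈ → record
      { elements = All.tabulate λ f∈ → ∈-elementsOf {tss} (∈-lookup g) t∈ f∈
      ; bounds   = proj₁ (valid g t∈)
      ; total    = proj₂ (valid g t∈)
      }
    }
    where
    tss = reducedSets (groups ℱ)
    valid : ∀ g {t} → t ∈ lookup tss g → Valid t
    valid g t∈ = All.lookup (All.lookup (reduced-valid (groups-valid ℱ)) (∈-lookup g)) t∈

  groups-reduce : ∀ ℱ → groups (reduce ℱ) ≡ reducedSets (groups ℱ)
  groups-reduce ℱ = List.tabulate-lookup (reducedSets (groups ℱ))

  reduce-equivalent : ∀ ℱ → Equivalent ℱ (reduce ℱ)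
  reduce-equivalent ℱ = mk⇔
    (λ sol → let s , cap = solution⇒selection ℱ sol in
      selection⇒solution (reduce ℱ) (subst HasSelection (sym (groups-reduce ℱ))
        (reducedChoice s , reducedChoice-within (groups-valid ℱ) s cap)))
    (λ sol → let s , cap   = subst HasSelection (groups-reduce ℱ) (solution⇒selection (reduce ℱ) sol)
                 s₀ , s₀≤ = selection-forced (groups-valid ℱ) s cap in
      selection⇒solution ℱ (s₀ , within λ b → ≤-trans (s₀≤ b) (load≤1 cap (original b))))

  -- Stated for an arbitrary f: with reduceᴰ in its place, the coefficient
  -- and the degree would be evaluated.
  PT⇒PolyTime : ∀ {X Y : Set} (encX : X → Data) (encY : Y → Data) (h : X → Y) {f} → PT f →
    (∀ x → f (encX x) ≡ encY (h x)) → PolyTime encX encY h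
  PT⇒PolyTime encX encY h F correct = prog , coefficient bound , degree bound , λ x →
    let t , d , t≤ = runs (encX x) in
    t , subst (λ y → prog ⊢ encX x ⇓ y [ t ]) (correct x) d , ℕ.≤-trans t≤
      (⟦⟧≤monomial bound (size>0 (encX x)))
    where open PT F

  reduceᴰ-encFMP : ∀ ℱ → reduceᴰ (encFMP ℱ) ≡ encFMP (reduce ℱ)
  reduceᴰ-encFMP ℱ = trans (reduceᴰ-correct (encList encElement (FMP.B ℱ)) (groups ℱ)
    (All.map (All.map proj₁) (groups-valid ℱ)))
    (cong (encList encElement (elementsOf (reducedSets (groups ℱ))) ∙_)
      (cong (encList encSets) (sym (groups-reduce ℱ))))

  reduce-polyTime : PolyTime encFMP encFMP reduce
  reduce-polyTime = PT⇒PolyTime encFMP encFMP reduce reduceᴾ reduceᴰ-encFMP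

  -- Freeness of the sinks

  allOf : List (List Tradeoff) → List Fragment
  allOf tss = concat (concat tss)

  allOf-concatSuffixes : ∀ {A : Set} (f : A → List A → List (List Tradeoff)) l →
    allOf (concatSuffixes f l) ≡ concatSuffixes (λ x xs → allOf (f x xs)) l
  allOf-concatSuffixes f []       = refl
  allOf-concatSuffixes f (x ∷ xs) = begin
    concat (concat (f x xs ++ concatSuffixes f xs))
      ≡⟨ cong concat (sym (List.concat-++ (f x xs) _)) ⟩
    concat (concat (f x xs) ++ concat (concatSuffixes f xs))
      ≡⟨ sym (List.concat-++ (concat (f x xs)) _) ⟩
    allOf (f x xs) ++ allOf (concatSuffixes f xs)
      ≡⟨ cong (allOf (f x xs) ++_) (allOf-concatSuffixes f xs) ⟩
    concatSuffixes (λ x xs → allOf (f x xs)) (x ∷ xs)          ∎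
    where open ≡-Reasoning

  allOf-supported : ∀ {P tss} → All (All (Supported P)) tss → Supported P (allOf tss)
  allOf-supported supported = All.concat⁺ (All.concat⁺ supported)

  load-allOf-private : ∀ {A : Set} {P : A → Set} (f : A → List A → List (List Tradeoff)) e m →
    (∀ x xs → length xs ≢ m → load e (allOf (f x xs)) ≡ 0ℚ) →
    (∀ x xs → P x → load e (allOf (f x xs)) ≤ 1ℚ) →
    ∀ {l} → All P l → load e (allOf (concatSuffixes f l)) ≤ 1ℚ
  load-allOf-private f e m zero-load ≤1 {l} ps =
    subst (λ fs → load e fs ≤ 1ℚ) (sym (allOf-concatSuffixes f l))
    (load-private _ e m zero-load ≤1 ps)

  -- All alternatives count here, not only chosen ones. The two spreads have different sinks, so a
  -- given sink meets at most one of them.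
  fragmentSets-free : ∀ g i f fs → Bounded f → ∀ g′ i′ j k →
    load (sink g′ i′ j k) (allOf (fragmentSets g i f fs)) ≤ 1ℚ
  fragmentSets-free g i (p , b) fs (0≤p , p≤1) g′ i′ j k with p ≟ 0ℚ
  ... | yes _ = 0≤1
  ... | no  _ = ≤-trans (≤-reflexive split) (go (≡-or-≢ z e))
    where
    n = length fs
    e = sink g′ i′ j k
    x = selector g i
    y = original b
    z = sink g i n 0
    w = sink g i n 1
    s = slot g i n
    s≢ : s ≢ e
    s≢ eq with _ , _ , _ , () ← fresh-injective eq
    x≢ : x ≢ e
    x≢ eq with _ , _ , () , _ ← fresh-injective eq
    split : load e (spread p x z ++ single s ++ single s ++ spread p y w ++ []) ≡
      load e (spread p x z) + load e (spread p y w)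
    split = begin
      load e (spread p x z ++ single s ++ single s ++ spread p y w ++ [])
        ≡⟨ load-++ e (spread p x z) _ ⟩
      load e (spread p x z) + load e (single s ++ single s ++ spread p y w ++ [])
        ≡⟨ cong (load e (spread p x z) +_) (trans (load-miss {1ℚ} _ s≢) (load-miss {1ℚ} _ s≢)) ⟩
      load e (spread p x z) + load e (spread p y w ++ [])
        ≡⟨ cong (λ fs → load e (spread p x z) + load e fs) (List.++-identityʳ (spread p y w)) ⟩
      load e (spread p x z) + load e (spread p y w) ∎
      where open ≡-Reasoning
    w≢z : w ≢ z
    w≢z eq with _ , _ , _ , () ← fresh-injective eq
    go : z ≡ e ⊎ z ≢ e → load e (spread p x z) + load e (spread p y w) ≤ 1ℚ
    go (inj₁ z≡e) = +0≤ (load-spread≤1 (selector≢sink {g} {i}) e 0≤p p≤1)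
      (load-spread-miss {p} original≢fresh λ w≡e → w≢z (trans w≡e (sym z≡e)))
    go (inj₂ z≢e) = 0+≤ (load-spread-miss {p} x≢ z≢e) (load-spread≤1 original≢fresh e 0≤p p≤1)

  fragments-free : ∀ g i {t} → All Bounded t → ∀ g′ i′ j k →
    load (sink g′ i′ j k) (allOf (concatSuffixes (fragmentSets g i) t)) ≤ 1ℚ
  fragments-free g i bounded g′ i′ j k = load-allOf-private (fragmentSets g i) (sink g′ i′ j k) j
    (λ f fs fs≢j → load-unsupported (allOf-supported (fragmentSets-supported g i f fs))
      λ { (_ , _ , inj₁ refl) → fs≢j refl ; (_ , _ , inj₂ (() , _)) })
    (λ f fs b → fragmentSets-free g i f fs b g′ i′ j k)
    bounded

  link≢sink : ∀ {g i g′ i′ j k} → link g i ≢ sink g′ i′ j k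
  link≢sink eq with _ , _ , () , _ ← fresh-injective eq

  load-tradeoffSets-sink : ∀ g t ts g′ i′ j k →
    load (sink g′ i′ j k) (allOf (tradeoffSets g t ts)) ≡
    load (sink g′ i′ j k) (allOf (concatSuffixes (fragmentSets g (suc (length ts))) t))
  load-tradeoffSets-sink g t ts g′ i′ j k =
    trans (load-miss {1ℚ} {e} {link g (suc n)} _ link≢sink)
      (trans (load-miss {1ℚ} {e} {selector g (suc n)} _ selector≢sink)
        (load-miss {1ℚ} {e} {link g n} (allOf (concatSuffixes (fragmentSets g (suc n)) t))
          link≢sink))
    where
    n = length ts
    e = sink g′ i′ j k

  tradeoffs-free : ∀ g {ts} → All Valid ts → ∀ g′ i j k →
    load (sink g′ i j k) (allOf (concatSuffixes (tradeoffSets g) ts)) ≤ 1ℚ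
  -- Tradeoffs are numbered from 1, so index `i` belongs to the suffix of length i - 1. For i = 0 no
  -- block matches, and the value 0 of `ℕ.pred` is harmless.
  tradeoffs-free g valid g′ i j k = load-allOf-private (tradeoffSets g) (sink g′ i j k) (ℕ.pred i)
    (λ t ts n≢ → trans (load-tradeoffSets-sink g t ts g′ i j k)
      (load-unsupported (allOf-supported (fragments-supported g (suc (length ts)) t))
        λ { (_ , refl , _) → n≢ refl }))
    (λ t ts (bounded , _) → ≤-trans (≤-reflexive (load-tradeoffSets-sink g t ts g′ i j k))
      (fragments-free g (suc (length ts)) bounded g′ i j k))
    valid

  reduced-free : ∀ {tss} → All (All Valid) tss → ∀ g i j k →
    load (sink g i j k) (allOf (reducedSets tss)) ≤ 1ℚ
  -- Groups are numbered from 1 as well.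
  reduced-free valid g i j k = load-allOf-private groupSets (sink g i j k) (ℕ.pred g)
    (λ ts tss n≢ → load-unsupported (allOf-supported (groupSets-supported ts tss))
      λ { refl → n≢ refl })
    (λ ts tss valid → let n = suc (length tss) in ≤-trans (≤-reflexive
      (trans (load-miss {1ℚ} {sink g i j k} {link n 0} _ link≢sink)
        (load-miss {1ℚ} {sink g i j k} {link n (length ts)}
          (allOf (concatSuffixes (tradeoffSets n) ts)) link≢sink)))
      (tradeoffs-free n valid g i j k))
    valid

  -- The shape of the tradeoff sets

  -- Freeness depends on the whole instance. Recording only the form of the name keeps `Restricted`
  -- a property of a single set; `sink-free` supplies the rest.
  IsSink : Element → Set
  IsSink b = ∃[ g ] ∃[ i ] ∃[ j ] ∃[ k ] b ≡ sink g i j k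

  Split : Tradeoff → Set
  Split t = ∃[ p ] ∃[ bᵢ ] ∃[ bⱼ ] t ≡ (p , bᵢ) ∷ (1ℚ - p , bⱼ) ∷ [] × 0ℚ < p × p < 1ℚ × IsSink bⱼ

  record Restricted (ts : List Tradeoff) : Set where
    field
      atMostThree         : length ts ℕ.≤ 3
      atMostOneFractional : AtMostOneFractional ts
      two                 : ∀ t → t ∈ ts → Fractional t → length ts ≡ 2
      split               : ∀ t → t ∈ ts → Fractional t → Split t

  integral-restricted : ∀ {ts} → length ts ℕ.≤ 3 → All Integral ts → Restricted ts
  integral-restricted ≤3 integral = record
    { atMostThree         = ≤3
    ; atMostOneFractional = λ i j fractional _ →
      ⊥-elim (fractional (All.lookup integral (∈-lookup i)))
    ; two                 = λ t t∈ fractional → ⊥-elim (fractional (All.lookup integral t∈))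
    ; split               = λ t t∈ fractional → ⊥-elim (fractional (All.lookup integral t∈))
    }

  mixed-restrictedˡ : ∀ {t u} → Split t → Integral u → Restricted (t ∷ u ∷ [])
  mixed-restrictedˡ t-split u-integral = record
    { atMostThree         = ℕ.n≤1+n 2
    ; atMostOneFractional = λ
      { zero       zero       _ _ → refl
      ; (suc zero) _          f _ → ⊥-elim (f u-integral)
      ; zero       (suc zero) _ f → ⊥-elim (f u-integral)
      }
    ; two                 = λ _ _ _ → refl
    ; split               = λ
      { _ (here refl)         _ → t-split
      ; _ (there (here refl)) f → ⊥-elim (f u-integral)
      }
    }

  mixed-restrictedʳ : ∀ {t u} → Integral t → Split u → Restricted (t ∷ u ∷ [])
  mixed-restrictedʳ t-integral u-split = record
    { atMostThree         = ℕ.n≤1+n 2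
    ; atMostOneFractional = λ
      { (suc zero) (suc zero) _ _ → refl
      ; zero       _          f _ → ⊥-elim (f t-integral)
      ; (suc zero) zero       _ f → ⊥-elim (f t-integral)
      }
    ; two                 = λ _ _ _ → refl
    ; split               = λ
      { _ (here refl)         f → ⊥-elim (f t-integral)
      ; _ (there (here refl)) _ → u-split
      }
    }

  single-integral : ∀ e → Integral (single e)
  single-integral e = e , refl

  spread-integral-or-split : ∀ {p} y {z} → 0ℚ < p → p ≤ 1ℚ → IsSink z → Integral (spread p y z) ⊎
    Split (spread p y z)
  spread-integral-or-split {p} y {z} 0<p p≤1 sink-z with 1ℚ - p ≟ 0ℚ
  -- Here p = 1 and the spread has a single fragment.
  ... | yes 1-p≡0 = inj₁ (y , cong (λ q → (q , y) ∷ [])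
    (trans (sym (+-identityʳ p)) (trans (cong (p +_) (sym 1-p≡0)) (p+[1-p]≡1 p))))
  ... | no  1-p≢0 = inj₂ (p , y , z , refl , 0<p , p<1 , sink-z)
    where
    p<1 : p < 1ℚ
    p<1 = ≰⇒> λ 1≤p → 1-p≢0 (trans (cong (λ q → 1ℚ - q) (≤-antisym p≤1 1≤p)) (+-inverseʳ 1ℚ))

  fragmentSets-restricted : ∀ g i f fs → Bounded f → All Restricted (fragmentSets g i f fs)
  fragmentSets-restricted g i (p , b) fs (0≤p , p≤1) with p ≟ 0ℚ
  ... | yes _   = []
  ... | no  p≢0 = firstSet (spreads (selector g i) 0) ∷ secondSet (spreads (original b) 1) ∷ []
    where
    n = length fs
    spreads : ∀ y k → Integral (spread p y (sink g i n k)) ⊎ Split (spread p y (sink g i n k))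
    spreads y k = spread-integral-or-split y (p≢0⇒0<p 0≤p p≢0) p≤1 (g , i , n , k , refl)
    firstSet : ∀ {t} → Integral t ⊎ Split t → Restricted (t ∷ single (slot g i n) ∷ [])
    firstSet (inj₁ integral) = integral-restricted (ℕ.n≤1+n 2) (integral ∷ single-integral _ ∷ [])
    firstSet (inj₂ t-split)  = mixed-restrictedˡ t-split (single-integral _)
    secondSet : ∀ {t} → Integral t ⊎ Split t → Restricted (single (slot g i n) ∷ t ∷ [])
    secondSet (inj₁ integral) = integral-restricted (ℕ.n≤1+n 2) (single-integral _ ∷ integral ∷ [])
    secondSet (inj₂ t-split)  = mixed-restrictedʳ (single-integral _) t-split

  reduced-restricted : ∀ {tss} → All (All Valid) tss → All Restricted (reducedSets tss)
  reduced-restricted = All-concatSuffixes λ ts tss valid →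
    integral-restricted (ℕ.s≤s ℕ.z≤n) (single-integral _ ∷ []) ∷
    integral-restricted (ℕ.s≤s ℕ.z≤n) (single-integral _ ∷ []) ∷
    All-concatSuffixes (λ t ts (bounded , _) →
      integral-restricted ℕ.≤-refl (single-integral _ ∷ single-integral _ ∷ single-integral _ ∷
        []) ∷
      All-concatSuffixes (fragmentSets-restricted (suc (length tss)) (suc (length ts))) bounded)
        valid

  reduce-restricted : ∀ ℱ g → Restricted (FMP.T (reduce ℱ) g)
  reduce-restricted ℱ g = All.lookup (reduced-restricted (groups-valid ℱ)) (∈-lookup g)

  sink-free : ∀ ℱ {b} → IsSink b → Free (reduce ℱ) b
  sink-free ℱ (g , i , j , k , refl) = subst (λ tss → load (sink g i j k) (allOf tss) ≤
    1ℚ) (sym (groups-reduce ℱ))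
    (reduced-free (groups-valid ℱ) g i j k)

open Correctness
open import Data.Nat.Base using (_≤_)
open import Data.Rational.Base using (_-_; _<_)

theorem4 :
    Σ[ reduce ∈ (FMP → FMP) ]
      PolyTime encFMP encFMP reduce ×
      (∀ (ℱ : FMP) →
        let ℱ′ = reduce ℱ
            open FMP ℱ′
        in
        Equivalent ℱ ℱ′ ×
        (∀ g → length (T g) ≤ 3) ×
        (∀ g → AtMostOneFractional (T g)) ×
        (∀ g t → t ∈ T g → Fractional t → length (T g) ≡ 2) ×
        (∀ g t → t ∈ T g → Fractional t →
          ∃[ p ] ∃[ bᵢ ] ∃[ bⱼ ]
            t ≡ (p , bᵢ) ∷ (1ℚ - p , bⱼ) ∷ [] ×
            0ℚ < p × p < 1ℚ ×
            Free ℱ′ bⱼ))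
theorem4 = reduce , reduce-polyTime , λ ℱ →
  reduce-equivalent ℱ ,
  (λ g → atMostThree (reduce-restricted ℱ g)) ,
  (λ g → atMostOneFractional (reduce-restricted ℱ g)) ,
  (λ g → two (reduce-restricted ℱ g)) ,
  λ g t t∈ fractional →
    let p , bᵢ , bⱼ , t≡ , 0<p , p<1 , bⱼ-sink = split (reduce-restricted ℱ g) t t∈ fractional in
    p , bᵢ , bⱼ , t≡ , 0<p , p<1 , sink-free ℱ bⱼ-sink
  where open Restricted
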